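{- Let $S_n$ be a star on $n\ge 2$ vertices and let $k\geq 2$. Then the spectrum of the Seidel matrix of the hyperstar $S_n^k$ is $$\sigma_S(S_n^k)=\begin{pmatrix}1 & 3-2k & r_1 & r_2\\ (n-1)(k-2) & n-2 & 1 & 1\end{pmatrix},$$ where $r_1$ and $r_2$ are the roots of the equation $$\lambda^2-((k-1)(n-3)+1)\lambda-(n-1)(k-1)=0.$$
   Context: A hypergraph $G^*=(V,E)$ has a finite vertex set $V=\{v_1,\dots,v_N\}$ and a finite set $E$ of hyperedges, each a subset of $V$. Its adjacency matrix $A=(a_{ij})$ has $a_{ij}=|\{e\in E:\{v_i,v_j\}\subset e\}|$ for $i\ne j$ and $a_{ii}=0$. Its Seidel matrix is $S=J_N-I_N-2A$ ($J_N$ all-ones matrix, $I_N$ identity). The hyperstar $S_n^k$ has the $(n-1)(k-1)+1$ vertices $v_{0,0}$ and $v_{i,j}$ ($1\le i\le n-1$, $1\le j\le k-1$), and the $n-1$ hyperedges $\{v_{0,0},v_{i,1},v_{i,2},\dots,v_{i,k-1}\}$, $1\le i\le n-1$. The two-row notation for a spectrum lists eigenvalues in the first row and multiplicities in the second; it is read as a multiset (if listed values coincide, their multiplicities add, and multiplicity $0$ means the entry is absent). -}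

module Defs where

open import Algebra.Apartness.Bundles using (HeytingField; HeytingCommutativeRing)
open import Algebra.Bundles using (CommutativeRing)
import Algebra.Properties.Semiring.Mult as Mult
import Algebra.Properties.Semiring.Sum as Sum
open import Data.Bool.Base using (if_then_else_)
open import Data.Fin.Base using (Fin; zero; suc; combine; fromℕ<)
open import Data.Fin.Properties using (_≟_; suc-injective; combine-injectiveˡ)
open import Data.Fin.Subset using (Subset; ⁅_⁆; ⊥; _∪_; ⋃; _∈_)
open import Data.Fin.Subset.Properties
  using (_⊆?_; ∉⊥; x∈⁅x⁆; x∈⁅y⁆⇒x≡y; x∈p∪q⁺; x∈p∪q⁻)
open import Data.Integer.Base as ℤ using (ℤ; +_; -[1+_])
open import Data.List.Base using (List; []; _∷_; map; filter; length; allFin)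
import Data.List.Membership.Propositional as List
open import Data.List.Membership.Propositional.Properties using (∈-allFin)
open import Data.List.Relation.Unary.Any using (here; there)
open import Data.List.Relation.Unary.Unique.Propositional using (Unique)
import Data.List.Relation.Unary.Unique.Propositional.Properties as Unique
open import Data.Nat.Base using (ℕ; zero; suc; _∸_; _≤_; _<_; s≤s)
import Data.Nat.Base as ℕ
open import Data.Nat.ListAction using (sum)
open import Data.Product.Base using (∃-syntax; _×_; _,_; proj₁; proj₂)
open import Data.Sum.Base using (inj₁; inj₂)
open import Data.Vec.Functional using (Vector)
open import Level using (_⊔_)
open import Relation.Binary.Definitions using (Decidable)
open import Relation.Binary.PropositionalEquality
  using (_≡_; refl; subst)
open import Relation.Nullary using (¬_; does; yes; no; contradiction)
open import Relation.Unary using (Pred)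

Matrix : ∀ {a} → Set a → ℕ → Set a
Matrix A n = Fin n → Fin n → A

-- The finite set of hyperedges is a list without repetitions.
record Hypergraph : Set where
  field
    order      : ℕ
    hyperedges : List (Subset order)
    distinct   : Unique hyperedges

open Hypergraph public

adjacency : (G : Hypergraph) → Matrix ℕ (order G)
adjacency G i j =
  if does (i ≟ j) then 0
  else length (filter (λ e → (⁅ i ⁆ ∪ ⁅ j ⁆) ⊆? e) (hyperedges G))

allOnes : ∀ n → Matrix ℤ n
allOnes n i j = + 1

identity : ∀ n → Matrix ℤ n
identity n i j = if does (i ≟ j) then + 1 else + 0

seidel : (G : Hypergraph) → Matrix ℤ (order G)
seidel G i j =
  allOnes (order G) i j ℤ.- identity (order G) i j ℤ.- + 2 ℤ.* + adjacency G i j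

-- Below, p = n ∸ 1 is the number of hyperedges and q = k ∸ 1 the number
-- of non-central vertices in each of them.
module _ (p q : ℕ) where

  starOrder : ℕ
  starOrder = suc (p ℕ.* q)

  centre : Fin starOrder
  centre = zero

  -- With 0-based indices, leaf i j is the vertex v_{i+1,j+1}.
  leaf : Fin p → Fin q → Fin starOrder
  leaf i j = suc (combine i j)

  starEdge : Fin p → Subset starOrder
  starEdge i = ⁅ centre ⁆ ∪ ⋃ (map (λ j → ⁅ leaf i j ⁆) (allFin q))

  private
    ∈-⋃⁺ : ∀ i j js → j List.∈ js → leaf i j ∈ ⋃ (map (λ j → ⁅ leaf i j ⁆) js)
    ∈-⋃⁺ i j (_ ∷ js) (here refl) = x∈p∪q⁺ (inj₁ (x∈⁅x⁆ (leaf i j)))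
    ∈-⋃⁺ i j (_ ∷ js) (there j∈js) = x∈p∪q⁺ (inj₂ (∈-⋃⁺ i j js j∈js))

    ∈-⋃⁻ : ∀ i x js → x ∈ ⋃ (map (λ j → ⁅ leaf i j ⁆) js) → ∃[ j ] x ≡ leaf i j
    ∈-⋃⁻ i x []       x∈ = contradiction x∈ ∉⊥
    ∈-⋃⁻ i x (j ∷ js) x∈ with x∈p∪q⁻ ⁅ leaf i j ⁆ _ x∈
    ... | inj₁ x∈₁ = j , x∈⁅y⁆⇒x≡y (leaf i j) x∈₁
    ... | inj₂ x∈₂ = ∈-⋃⁻ i x js x∈₂

    leaf∈starEdge⇒≡ : ∀ i i′ j → leaf i j ∈ starEdge i′ → i ≡ i′
    leaf∈starEdge⇒≡ i i′ j x∈ with x∈p∪q⁻ ⁅ centre ⁆ _ x∈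
    ... | inj₁ x∈₁ = contradiction (x∈⁅y⁆⇒x≡y centre x∈₁) λ ()
    ... | inj₂ x∈₂ with ∈-⋃⁻ i′ (leaf i j) (allFin q) x∈₂
    ...   | j′ , eq = combine-injectiveˡ i j i′ j′ (suc-injective eq)

  -- Injectivity needs a non-central vertex in each edge.
  starEdge-injective : 0 < q → ∀ {i i′} → starEdge i ≡ starEdge i′ → i ≡ i′
  starEdge-injective 0<q {i} {i′} eq =
    leaf∈starEdge⇒≡ i i′ j (subst (leaf i j ∈_) eq
      (x∈p∪q⁺ (inj₂ (∈-⋃⁺ i j (allFin q) (∈-allFin j)))))
    where
    j : Fin q
    j = fromℕ< 0<q

hyperstar : (n k : ℕ) → 2 ≤ k → Hypergraph
hyperstar n (suc (suc k)) (s≤s 0<q) = record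
  { order      = starOrder p q
  ; hyperedges = map (starEdge p q) (allFin p)
  ; distinct   = Unique.map⁺ (starEdge-injective p q 0<q) (Unique.allFin⁺ p)
  }
  where
  p = n ∸ 1
  q = suc k

-- A Heyting field with decidable apartness is a field in the usual sense:
-- apartness is then the negation of equality.  Classically ℝ is an instance.
module Field {c ℓ₁ ℓ₂} (K : HeytingField c ℓ₁ ℓ₂)
             (_#?_ : Decidable (HeytingField._#_ K)) where

  open HeytingField K hiding (refl; sym; trans; zero)
  open CommutativeRing (HeytingCommutativeRing.commutativeRing heytingCommutativeRing)
    using (semiring)
  open Mult semiring using () renaming (_×_ to _·_)
  open Sum semiring using () renaming (sum to ∑)

  _≈?_ : Decidable _≈_
  x ≈? y with x #? y
  ... | yes x#y = no (λ x≈y → #-irrefl x≈y x#y)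
  ... | no ¬x#y = yes (proj₁ (tight x y) ¬x#y)

  ι : ℤ → Carrier
  ι (+ m)    = m · 1#
  ι -[1+ m ] = - (suc m · 1#)

  CharacteristicZero : Set ℓ₁
  CharacteristicZero = ∀ m → ¬ (ι (+ suc m) ≈ 0#)

  linearCombination : ∀ {m N} → Vector Carrier m → (Fin m → Vector Carrier N) →
                      Vector Carrier N
  linearCombination a b j = ∑ (λ i → a i * b i j)

  LinearlyIndependent : ∀ {m N} → (Fin m → Vector Carrier N) → Set (c ⊔ ℓ₁)
  LinearlyIndependent b =
    ∀ a → (∀ j → linearCombination a b j ≈ 0#) → ∀ i → a i ≈ 0#

  -- The predicate U is meant to be a linear subspace of K^N.
  HasDimension : ∀ {N ℓ} → Pred (Vector Carrier N) ℓ → ℕ → Set (c ⊔ ℓ₁ ⊔ ℓ)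
  HasDimension {N} U m = ∃[ b ]
      (∀ (i : Fin m) → U (b i))
    × LinearlyIndependent b
    × (∀ (v : Vector Carrier N) → U v →
         ∃[ a ] (∀ j → v j ≈ linearCombination a b j))

  Eigenspace : ∀ {N} → Matrix Carrier N → Carrier → Pred (Vector Carrier N) ℓ₁
  Eigenspace M x v = ∀ i → ∑ (λ j → M i j * v j) ≈ x * v i

  multiplicity : List (Carrier × ℕ) → Carrier → ℕ
  multiplicity σ x = sum (map proj₂ (filter (λ entry → proj₁ entry ≈? x) σ))

  -- σ is the two-row symbol, read column by column as (eigenvalue , multiplicity);
  -- columns with equal eigenvalues add up.  Multiplicities are dimensions of
  -- eigenspaces; for real symmetric matrices these are also the multiplicities
  -- as roots of the characteristic polynomial.  The second component says that
  -- the symbol accounts for all N eigenvalues, none lying outside K.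
  HasSpectrum : ∀ {N} → Matrix Carrier N → List (Carrier × ℕ) → Set (c ⊔ ℓ₁)
  HasSpectrum {N} M σ =
      (∀ x → HasDimension (Eigenspace M x) (multiplicity σ x))
    × sum (map proj₂ σ) ≡ N

  HasSeidelSpectrum : Hypergraph → List (Carrier × ℕ) → Set (c ⊔ ℓ₁)
  HasSeidelSpectrum G = HasSpectrum (λ i j → ι (seidel G i j))

{-# OPTIONS --safe #-}

-- Write p = n − 1 for the number of hyperedges, q = k − 1 for the number of leaves in each.
-- For a vector v with value c at the centre, leaf values x, edge sums e and total leaf
-- sum t, the Seidel matrix maps c to −t and x to t − 2e − c + x.  Averaging over edges,
-- and then over all leaves, splits K^N into
--   the vectors with c = 0 and all e = 0                    (eigenvalue 1, dimension p(q − 1)),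
--   those with c = 0, t = 0, constant on the leaves of each edge
--                                                           (eigenvalue 1 − 2q, dimension p − 1),
--   those constant on all leaves                            (dimension 2).
-- The last space is the sum of the lines c = r₂x and c = r₁x, which are eigenlines for r₁
-- and r₂ by Vieta.  They differ since the discriminant is a positive integer, hence nonzero
-- in K.  Splitting off one eigenspace at a time adds dimensions exactly as coinciding
-- eigenvalues of the symbol add up, so no coincidence has to be treated separately.
module Submission where

open import Defs

open import Algebra.Apartness.Bundles using (HeytingField; HeytingCommutativeRing)
open import Algebra.Bundles using (CommutativeRing)
import Algebra.Properties.AbelianGroup
import Algebra.Properties.Ring
import Algebra.Properties.Semiring.Mult
import Algebra.Properties.Semiring.Sum
import Algebra.Solver.Ring
open import Algebra.Solver.Ring.AlmostCommutativeRing using (fromCommutativeRing; _-Raw-AlmostCommutative⟶_)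
open import Data.Bool.Base using (if_then_else_)
open import Data.Empty using (⊥)
open import Data.Fin.Base using (Fin; zero; suc; combine; join; remQuot; splitAt; _↑ˡ_; _↑ʳ_)
open import Data.Fin.Properties
  using (_≟_; suc-injective; combine-injective; combine-injectiveˡ; remQuot-combine; combine-remQuot;
         splitAt-↑ˡ; splitAt-↑ʳ; join-splitAt)
open import Data.Fin.Subset using (⁅_⁆; _∪_; ⋃; _∈_)
open import Data.Fin.Subset.Properties using (_⊆?_; ∉⊥; x∈⁅x⁆; x∈⁅y⁆⇒x≡y; x∈p∪q⁺; x∈p∪q⁻)
open import Data.Integer.Base as ℤ using (+_; -[1+_]; _⊖_)
import Data.Integer.Properties as ℤ
open import Data.List.Base using (List; []; _∷_; map; filter; length; allFin; tabulate)
open import Data.List.Membership.Propositional using () renaming (_∈_ to _∈ₗ_)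
open import Data.List.Membership.Propositional.Properties using (∈-allFin)
open import Data.List.Properties using (map-tabulate; filter-accept; filter-reject; filter-none)
open import Data.List.Relation.Unary.All.Properties using (tabulate⁺)
open import Data.List.Relation.Unary.Any using (here; there)
open import Data.Maybe.Base using (Maybe; just; nothing)
open import Data.Nat.Base as ℕ using (ℕ; zero; suc; _∸_; _≤_; _<_; s≤s)
import Data.Nat.Properties as ℕ
open import Data.Nat.Tactic.RingSolver using (solve-∀)
open import Data.Product.Base using (∃-syntax; Σ-syntax; _×_; _,_; proj₁; proj₂; uncurry)
open import Data.Sum.Base using (_⊎_; inj₁; inj₂; [_,_]′)
open import Data.Vec.Functional using (Vector)
open import Function.Base using (_∘_; id)
open import Function.Bundles using (_⇔_; Equivalence)
open import Level using (_⊔_)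
open import Relation.Binary.Definitions using (Decidable)
open import Relation.Binary.PropositionalEquality as ≡ using (_≡_; _≢_)
open import Relation.Nullary using (¬_; does; yes; no; contradiction)
open import Relation.Nullary.Decidable using (dec-true; dec-false)
open import Relation.Unary as Unary using (Pred; _∩_)

-- Counting the entries of a tabulated list that satisfy a predicate

length-filter-tabulate-none :
  ∀ {a ℓ} {A : Set a} {P : Pred A ℓ} (P? : Unary.Decidable P) {n} (f : Fin n → A) →
  (∀ j → ¬ P (f j)) → length (filter P? (tabulate f)) ≡ 0
length-filter-tabulate-none P? f ¬Pf = ≡.cong length (filter-none P? (tabulate⁺ ¬Pf))

length-filter-tabulate-one :
  ∀ {a ℓ} {A : Set a} {P : Pred A ℓ} (P? : Unary.Decidable P) {n} (f : Fin n → A) i →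
  P (f i) → (∀ j → P (f j) → i ≡ j) → length (filter P? (tabulate f)) ≡ 1
length-filter-tabulate-one P? f zero Pfi unique = ≡.trans
  (≡.cong length (filter-accept P? Pfi))
  (≡.cong suc (length-filter-tabulate-none P? (f ∘ suc) λ j Pfj → contradiction (unique (suc j) Pfj) λ ()))
length-filter-tabulate-one P? f (suc i) Pfi unique = ≡.trans
  (≡.cong length (filter-reject P? λ Pf0 → contradiction (unique zero Pf0) λ ()))
  (length-filter-tabulate-one P? (f ∘ suc) i Pfi λ j Pfj → suc-injective (unique (suc j) Pfj))

-- Vertices and edges of the hyperstar

module _ {p q : ℕ} where

  leaf∈⋃⁺ : ∀ i {j js} → j ∈ₗ js → leaf p q i j ∈ ⋃ (map (λ j → ⁅ leaf p q i j ⁆) js)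
  leaf∈⋃⁺ i {j} (here ≡.refl) = x∈p∪q⁺ (inj₁ (x∈⁅x⁆ (leaf p q i j)))
  leaf∈⋃⁺ i (there j∈js) = x∈p∪q⁺ (inj₂ (leaf∈⋃⁺ i j∈js))

  ∈⋃⇒leaf : ∀ i x js → x ∈ ⋃ (map (λ j → ⁅ leaf p q i j ⁆) js) → ∃[ j ] x ≡ leaf p q i j
  ∈⋃⇒leaf i x []       x∈ = contradiction x∈ ∉⊥
  ∈⋃⇒leaf i x (j ∷ js) x∈ with x∈p∪q⁻ ⁅ leaf p q i j ⁆ _ x∈
  ... | inj₁ x∈₁ = j , x∈⁅y⁆⇒x≡y (leaf p q i j) x∈₁
  ... | inj₂ x∈₂ = ∈⋃⇒leaf i x js x∈₂

  centre∈starEdge : ∀ i → centre p q ∈ starEdge p q i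
  centre∈starEdge i = x∈p∪q⁺ (inj₁ (x∈⁅x⁆ (centre p q)))

  leaf∈starEdge : ∀ i j → leaf p q i j ∈ starEdge p q i
  leaf∈starEdge i j = x∈p∪q⁺ (inj₂ (leaf∈⋃⁺ i (∈-allFin j)))

  leaf∈starEdge⇒≡ : ∀ {i j} i′ → leaf p q i j ∈ starEdge p q i′ → i ≡ i′
  leaf∈starEdge⇒≡ {i} {j} i′ x∈ with x∈p∪q⁻ ⁅ centre p q ⁆ _ x∈
  ... | inj₁ x∈₁ = contradiction (x∈⁅y⁆⇒x≡y (centre p q) x∈₁) λ ()
  ... | inj₂ x∈₂ with ∈⋃⇒leaf i′ (leaf p q i j) (allFin q) x∈₂
  ...   | j′ , eq = combine-injectiveˡ i j i′ j′ (suc-injective eq)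

  leaf-injective : ∀ {i j i′ j′} → leaf p q i j ≡ leaf p q i′ j′ → i ≡ i′ × j ≡ j′
  leaf-injective {i} {j} {i′} {j′} = combine-injective i j i′ j′ ∘ suc-injective

  -- Since `combine` is surjective, checking the centre and the leaves suffices. Pointwise
  -- statements about vectors are reduced to these two cases with it.
  ∀-vertex : ∀ {ℓ} (P : Pred (Fin (starOrder p q)) ℓ) →
             P (centre p q) → (∀ i j → P (leaf p q i j)) → ∀ x → P x
  ∀-vertex P Pc Pl zero = Pc
  ∀-vertex P Pc Pl (suc x) = ≡.subst (P ∘ suc) (combine-remQuot {p} q x) (uncurry Pl (remQuot q x))

  -- Builds a vector from its centre value and its doubly indexed leaf values, the coordinates in
  -- which the Seidel matrix is easy to describe.
  assemble : ∀ {a} {A : Set a} → A → (Fin p → Fin q → A) → Fin (starOrder p q) → A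
  assemble x g zero    = x
  assemble x g (suc y) = uncurry g (remQuot q y)

  assemble-leaf : ∀ {a} {A : Set a} (x : A) g i j → assemble x g (leaf p q i j) ≡ g i j
  assemble-leaf x g i j = ≡.cong (uncurry g) (remQuot-combine i j)

-- Entries of the Seidel matrix

module _ {p q : ℕ} (0<q : 0 < suc q) where

  private
    G = hyperstar (suc p) (suc (suc q)) (s≤s 0<q)
    star = starEdge p (suc q)
    ℓ = leaf p (suc q)
    o = centre p (suc q)

    pair⊆⁺ : ∀ {n} {x y : Fin n} {e} → x ∈ e → y ∈ e → ∀ {z} → z ∈ ⁅ x ⁆ ∪ ⁅ y ⁆ → z ∈ e
    pair⊆⁺ {x = x} {y} x∈e y∈e z∈ with x∈p∪q⁻ ⁅ x ⁆ _ z∈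
    ... | inj₁ z∈x with ≡.refl ← x∈⁅y⁆⇒x≡y x z∈x = x∈e
    ... | inj₂ z∈y with ≡.refl ← x∈⁅y⁆⇒x≡y y z∈y = y∈e

    -- The count in `adjacency` without its diagonal case: at `x = y` this is the ordinary vertex
    -- degree, which `adjacency` replaces by 0.
    degree : ∀ x y → ℕ
    degree x y = length (filter ((⁅ x ⁆ ∪ ⁅ y ⁆) ⊆?_) (map star (allFin p)))

    degree-one : ∀ x y i → x ∈ star i → y ∈ star i →
                 (∀ j → x ∈ star j → y ∈ star j → i ≡ j) → degree x y ≡ 1
    degree-one x y i x∈ y∈ unique = ≡.trans
      (≡.cong (length ∘ filter _) (map-tabulate id star))
      (length-filter-tabulate-one _ star i (pair⊆⁺ x∈ y∈) λ j x,y⊆ →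
        unique j (x,y⊆ (x∈p∪q⁺ (inj₁ (x∈⁅x⁆ x)))) (x,y⊆ (x∈p∪q⁺ (inj₂ (x∈⁅x⁆ y)))))

    degree-none : ∀ x y → (∀ j → x ∈ star j → y ∈ star j → ⊥) → degree x y ≡ 0
    degree-none x y none = ≡.trans
      (≡.cong (length ∘ filter _) (map-tabulate id star))
      (length-filter-tabulate-none _ star λ j x,y⊆ →
        none j (x,y⊆ (x∈p∪q⁺ (inj₁ (x∈⁅x⁆ x)))) (x,y⊆ (x∈p∪q⁺ (inj₂ (x∈⁅x⁆ y)))))

    -- The right-hand side is left unevaluated so that it computes to -1 for `d = 1` and to 1 for
    -- `d = 0`.
    seidel-off : ∀ x y {d} → x ≢ y → degree x y ≡ d →
                 seidel G x y ≡ + 1 ℤ.- + 0 ℤ.- + 2 ℤ.* + d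
    seidel-off x y x≢y ≡.refl rewrite dec-false (x ≟ y) x≢y = ≡.refl

  seidel-diagonal : ∀ x → seidel G x x ≡ + 0
  seidel-diagonal x rewrite dec-true (x ≟ x) ≡.refl = ≡.refl

  seidel-centre-leaf : ∀ i j → seidel G o (ℓ i j) ≡ -[1+ 0 ]
  seidel-centre-leaf i j = seidel-off o (ℓ i j) (λ ())
    (degree-one o (ℓ i j) i (centre∈starEdge i) (leaf∈starEdge i j) λ k _ → leaf∈starEdge⇒≡ k)

  seidel-leaf-centre : ∀ i j → seidel G (ℓ i j) o ≡ -[1+ 0 ]
  seidel-leaf-centre i j = seidel-off (ℓ i j) o (λ ())
    (degree-one (ℓ i j) o i (leaf∈starEdge i j) (centre∈starEdge i) λ k l∈ _ → leaf∈starEdge⇒≡ k l∈)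

  seidel-same-edge : ∀ i {j j′} → j ≢ j′ → seidel G (ℓ i j) (ℓ i j′) ≡ -[1+ 0 ]
  seidel-same-edge i {j} {j′} j≢j′ = seidel-off (ℓ i j) (ℓ i j′) (j≢j′ ∘ proj₂ ∘ leaf-injective {p})
    (degree-one (ℓ i j) (ℓ i j′) i (leaf∈starEdge i j) (leaf∈starEdge i j′) λ k l∈ _ → leaf∈starEdge⇒≡ k l∈)

  seidel-distinct-edges : ∀ {i i′} j j′ → i ≢ i′ → seidel G (ℓ i j) (ℓ i′ j′) ≡ + 1
  seidel-distinct-edges {i} {i′} j j′ i≢i′ =
    seidel-off (ℓ i j) (ℓ i′ j′) (i≢i′ ∘ proj₁ ∘ leaf-injective {p})
      (degree-none (ℓ i j) (ℓ i′ j′) λ k l∈ l′∈ →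
        i≢i′ (≡.trans (leaf∈starEdge⇒≡ k l∈) (≡.sym (leaf∈starEdge⇒≡ k l′∈))))

-- The homomorphism from the integers, and division

module FieldProperties {c ℓ₁ ℓ₂} (K : HeytingField c ℓ₁ ℓ₂)
                       (_#?_ : Decidable (HeytingField._#_ K)) where

  open HeytingField K hiding (zero) public
  open Field K _#?_ public

  commRing : CommutativeRing c ℓ₁
  commRing = HeytingCommutativeRing.commutativeRing heytingCommutativeRing
  open CommutativeRing commRing using (semiring; ring; +-abelianGroup) public
  open Algebra.Properties.Ring ring using (-‿distribˡ-*; -‿distribʳ-*; -0#≈0#; -‿involutive) public
  open Algebra.Properties.AbelianGroup +-abelianGroup using (⁻¹-∙-comm)
    renaming (x∙y⁻¹≈ε⇒x≈y to x-y≈0⇒x≈y) public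
  open Algebra.Properties.Semiring.Mult semiring using (×-homo-+; ×-assoc-*) renaming (_×_ to _·_) public
  open Algebra.Properties.Semiring.Sum semiring
    using (sum-cong-≋; sum-replicate; sum-replicate-zero; ∑-distrib-+; ∑-comm; *-distribˡ-sum; *-distribʳ-sum)
    renaming (sum to ∑) public
  open import Relation.Binary.Reasoning.Setoid setoid public

  infix 4 _≋_
  _≋_ : ∀ {n} → Vector Carrier n → Vector Carrier n → Set ℓ₁
  v ≋ w = ∀ i → v i ≈ w i

  1≈ι1 : 1# ≈ ι (+ 1)
  1≈ι1 = sym (+-identityʳ 1#)

  ι-⊖ : ∀ m n → ι (m ⊖ n) ≈ m · 1# - n · 1#
  ι-⊖ m zero = sym (trans (+-congˡ -0#≈0#) (+-identityʳ _))
  ι-⊖ zero (suc n) = sym (+-identityˡ _)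
  ι-⊖ (suc m) (suc n) = begin
    ι (suc m ⊖ suc n)                   ≡⟨ ≡.cong ι (ℤ.[1+m]⊖[1+n]≡m⊖n m n) ⟩
    ι (m ⊖ n)                           ≈⟨ ι-⊖ m n ⟩
    m · 1# - n · 1#                     ≈⟨ +-congˡ (+-identityˡ _) ⟨
    -- The zero is expanded to `1# - 1#`, which raises both multiples by one.
    m · 1# + (0# - n · 1#)              ≈⟨ +-congˡ (+-congʳ (-‿inverseʳ 1#)) ⟨
    m · 1# + (1# - 1# - n · 1#)         ≈⟨ +-congˡ (+-assoc _ _ _) ⟩
    m · 1# + (1# + (- 1# - n · 1#))     ≈⟨ +-assoc _ _ _ ⟨
    m · 1# + 1# + (- 1# - n · 1#)       ≈⟨ +-cong (+-comm _ _) (⁻¹-∙-comm _ _) ⟩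
    suc m · 1# - suc n · 1#             ∎

  ι-homo-+ : ∀ i j → ι (i ℤ.+ j) ≈ ι i + ι j
  ι-homo-+ (+ m)    (+ n)    = ×-homo-+ 1# m n
  ι-homo-+ (+ m)    -[1+ n ] = ι-⊖ m (suc n)
  ι-homo-+ -[1+ m ] (+ n)    = trans (ι-⊖ n (suc m)) (+-comm _ _)
  ι-homo-+ -[1+ m ] -[1+ n ] = begin
    - ι (+ suc (suc (m ℕ.+ n)))       ≡⟨ ≡.cong (-_ ∘ ι ∘ +_ ∘ suc) (ℕ.+-suc m n) ⟨
    - ι (+ (suc m ℕ.+ suc n))         ≈⟨ -‿cong (×-homo-+ 1# (suc m) (suc n)) ⟩
    - (ι (+ suc m) + ι (+ suc n))     ≈⟨ ⁻¹-∙-comm _ _ ⟨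
    - ι (+ suc m) - ι (+ suc n)       ∎

  ι-homo‿- : ∀ i → ι (ℤ.- i) ≈ - ι i
  ι-homo‿- (+ zero)  = sym -0#≈0#
  ι-homo‿- (+ suc m) = refl
  ι-homo‿- -[1+ m ]  = sym (-‿involutive _)

  -- Induction on `m` through (1 + m)j = j + mj leaves `j` an arbitrary integer, so only the left
  -- factor is ever split by sign.
  ι-homo-+* : ∀ m j → ι (+ m ℤ.* j) ≈ ι (+ m) * ι j
  ι-homo-+* zero    j = trans (reflexive (≡.cong ι (ℤ.*-zeroˡ j))) (sym (zeroˡ _))
  ι-homo-+* (suc m) j = begin
    ι (+ suc m ℤ.* j)        ≡⟨ ≡.cong ι (ℤ.suc-* (+ m) j) ⟩
    ι (j ℤ.+ + m ℤ.* j)      ≈⟨ ι-homo-+ j _ ⟩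
    ι j + ι (+ m ℤ.* j)      ≈⟨ +-cong (sym (*-identityˡ _)) (ι-homo-+* m j) ⟩
    1# * ι j + ι (+ m) * ι j ≈⟨ distribʳ _ _ _ ⟨
    ι (+ suc m) * ι j        ∎

  ι-homo-* : ∀ i j → ι (i ℤ.* j) ≈ ι i * ι j
  ι-homo-* (+ m)    j = ι-homo-+* m j
  ι-homo-* -[1+ m ] j = begin
    ι (-[1+ m ] ℤ.* j)        ≡⟨ ≡.cong ι (ℤ.neg-distribˡ-* (+ suc m) j) ⟨
    ι (ℤ.- (+ suc m ℤ.* j))   ≈⟨ ι-homo‿- (+ suc m ℤ.* j) ⟩
    - ι (+ suc m ℤ.* j)       ≈⟨ -‿cong (ι-homo-+* (suc m) j) ⟩
    - (ι (+ suc m) * ι j)     ≈⟨ -‿distribˡ-* _ _ ⟩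
    - ι (+ suc m) * ι j       ∎

  ι-homo-- : ∀ i j → ι (i ℤ.- j) ≈ ι i - ι j
  ι-homo-- i j = trans (ι-homo-+ i (ℤ.- j)) (+-congˡ (ι-homo‿- j))

  -- Gives the ring solver integer coefficients, with `con z` read as `ι z`. Constants are therefore
  -- mostly written `ι (+ 1)` below, which unfolds to `1# + 0#` and has to be converted by `1≈ι1`
  -- where `1#` occurs.
  ι-morphism : ℤ.+-*-rawRing -Raw-AlmostCommutative⟶ fromCommutativeRing commRing
  ι-morphism = record
    { ⟦_⟧    = ι
    ; +-homo = ι-homo-+
    ; *-homo = ι-homo-*
    ; -‿homo = ι-homo‿-
    ; 0-homo = refl
    ; 1-homo = sym 1≈ι1
    }

  -- Distinct integers are left undecided, because `ι` is injective only in characteristic zero,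
  -- which is not assumed here.
  ι-≟ : ∀ i j → Maybe (ι i ≈ ι j)
  ι-≟ i j with i ℤ.≟ j
  ... | yes i≡j = just (reflexive (≡.cong ι i≡j))
  ... | no  _   = nothing

  open Algebra.Solver.Ring ℤ.+-*-rawRing (fromCommutativeRing commRing) ι-morphism ι-≟
    using (solve; con; _:=_; _:+_; _:*_; _:-_; :-_) public

  -- Inverses come from apartness; as apartness is decidable, tightness yields it from the negated
  -- equality.
  invertible : ∀ {x y} → ¬ (x ≈ y) → ∃[ z ] z * (x - y) ≈ 1#
  invertible {x} {y} x≉y with x #? y
  ... | yes x#y = proj₁ (#⇒invertible x#y) , proj₁ (proj₂ (#⇒invertible x#y))
  ... | no ¬x#y = contradiction (proj₁ (tight x y) ¬x#y) x≉y

  inverse : ∀ {x} → ¬ (x ≈ 0#) → ∃[ z ] z * x ≈ 1#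
  inverse {x} x≉0 with invertible x≉0
  ... | z , z[x-0]≈1 = z , trans (*-congˡ (sym (trans (+-congˡ -0#≈0#) (+-identityʳ x)))) z[x-0]≈1

  divide : ∀ {x} → ¬ (x ≈ 0#) → ∀ y → ∃[ z ] x * z ≈ y
  divide {x} x≉0 y with inverse x≉0
  ... | x⁻¹ , x⁻¹x≈1 = x⁻¹ * y , (begin
    x * (x⁻¹ * y) ≈⟨ solve 3 (λ a b y → a :* (b :* y) := b :* a :* y) refl x x⁻¹ y ⟩
    x⁻¹ * x * y   ≈⟨ *-congʳ x⁻¹x≈1 ⟩
    1# * y        ≈⟨ *-identityˡ y ⟩
    y             ∎)

  cancelˡ : ∀ {x y} → ¬ (x ≈ 0#) → x * y ≈ 0# → y ≈ 0#
  cancelˡ {x} {y} x≉0 xy≈0 with inverse x≉0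
  ... | z , zx≈1 = begin
    y           ≈⟨ *-identityˡ y ⟨
    1# * y      ≈⟨ *-congʳ zx≈1 ⟨
    z * x * y   ≈⟨ *-assoc z x y ⟩
    z * (x * y) ≈⟨ *-congˡ xy≈0 ⟩
    z * 0#      ≈⟨ zeroʳ z ⟩
    0#          ∎

  -- Finite sums

  ∑-zero : ∀ {n} {f : Vector Carrier n} → (∀ i → f i ≈ 0#) → ∑ f ≈ 0#
  ∑-zero {n} f≈0 = trans (sum-cong-≋ {n} f≈0) (sum-replicate-zero n)

  ∑-neg : ∀ {n} (f : Vector Carrier n) → ∑ (λ i → - f i) ≈ - ∑ f
  ∑-neg {zero}  f = sym -0#≈0#
  ∑-neg {suc n} f = trans (+-congˡ (∑-neg (f ∘ suc))) (⁻¹-∙-comm _ _)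

  ∑-const : ∀ {n} {f : Vector Carrier n} {x} → (∀ i → f i ≈ x) → ∑ f ≈ ι (+ n) * x
  ∑-const {n} {f} {x} f≈x = begin
    ∑ f            ≈⟨ sum-cong-≋ {n} f≈x ⟩
    ∑ {n} (λ _ → x) ≈⟨ sum-replicate n ⟩
    n · x          ≈⟨ ·-cong n ⟩
    n · (1# * x)   ≈⟨ ×-assoc-* n 1# x ⟨
    ι (+ n) * x    ∎
    where
    ·-cong : ∀ n → n · x ≈ n · (1# * x)
    ·-cong zero    = refl
    ·-cong (suc n) = +-cong (sym (*-identityˡ x)) (·-cong n)

  ∑-↑ : ∀ m {n} (f : Vector Carrier (m ℕ.+ n)) →
        ∑ f ≈ ∑ (λ i → f (i ↑ˡ n)) + ∑ (λ i → f (m ↑ʳ i))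
  ∑-↑ zero    f = sym (+-identityˡ _)
  ∑-↑ (suc m) f = trans (+-congˡ (∑-↑ m (f ∘ suc))) (sym (+-assoc _ _ _))

  ∑-combine : ∀ m n (f : Vector Carrier (m ℕ.* n)) →
              ∑ f ≈ ∑ (λ i → ∑ (λ j → f (combine {m} {n} i j)))
  ∑-combine zero    n f = refl
  ∑-combine (suc m) n f = trans (∑-↑ n f) (+-congˡ (∑-combine m n (f ∘ (n ↑ʳ_))))

  δ : ∀ {n} → Fin n → Fin n → Carrier
  δ i j = if does (i ≟ j) then 1# else 0#

  ∑-δ : ∀ {n} (i : Fin n) (f : Vector Carrier n) → ∑ (λ j → δ i j * f j) ≈ f i
  ∑-δ {suc n} zero f = trans
    (+-cong (*-identityˡ _) (∑-zero {n} λ j → zeroˡ _)) (+-identityʳ _)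
  ∑-δ {suc n} (suc i) f = begin
    0# * f zero + ∑ (λ j → δ (suc i) (suc j) * f (suc j)) ≈⟨ +-cong (zeroˡ _) (sum-cong-≋ {n} λ j → *-congʳ (δ-suc j)) ⟩
    0# + ∑ (λ j → δ i j * f (suc j))                      ≈⟨ +-identityˡ _ ⟩
    ∑ (λ j → δ i j * f (suc j))                           ≈⟨ ∑-δ i (f ∘ suc) ⟩
    f (suc i)                                             ∎
    where
    δ-suc : ∀ j → δ (suc i) (suc j) ≈ δ i j
    δ-suc j with i ≟ j
    ... | yes _ = refl
    ... | no  _ = refl

  -- Linear functionals and the subspaces they cut out

  -- Linearity of f is witnessed by its coefficient vector.
  Functional : ∀ {n} → (Vector Carrier n → Carrier) → Set (c ⊔ ℓ₁)
  Functional {n} f = Σ[ b ∈ Vector Carrier n ] (∀ v → f v ≈ ∑ {n} (λ i → v i * b i))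

  functional-coordinate : ∀ {n} (i : Fin n) → Functional {n} (λ v → v i)
  functional-coordinate {n} i = δ i , λ v → sym (trans (sum-cong-≋ {n} λ j → *-comm (v j) (δ i j)) (∑-δ i v))

  functional-0 : ∀ {n} → Functional {n} (λ v → 0#)
  functional-0 {n} = (λ i → 0#) , λ v → sym (∑-zero {n} λ i → zeroʳ (v i))

  functional-*ˡ : ∀ {n} x {f : Vector Carrier n → Carrier} → Functional f → Functional {n} (λ v → x * f v)
  functional-*ˡ {n} x (b , f≈) = (λ i → x * b i) , λ v → begin
    x * _                          ≈⟨ *-congˡ (f≈ v) ⟩
    x * ∑ {n} (λ i → v i * b i)    ≈⟨ *-distribˡ-sum {n} x (λ i → v i * b i) ⟩
    ∑ {n} (λ i → x * (v i * b i))
      ≈⟨ sum-cong-≋ {n} (λ i → solve 3 (λ x v b → x :* (v :* b) := v :* (x :* b)) refl x (v i) (b i)) ⟩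
    ∑ {n} (λ i → v i * (x * b i))  ∎

  functional-neg : ∀ {n} {f : Vector Carrier n → Carrier} → Functional f → Functional {n} (λ v → - f v)
  functional-neg {n} (b , f≈) = (λ i → - b i) , λ v → begin
    - _                         ≈⟨ -‿cong (f≈ v) ⟩
    - ∑ {n} (λ i → v i * b i)   ≈⟨ ∑-neg {n} (λ i → v i * b i) ⟨
    ∑ {n} (λ i → - (v i * b i)) ≈⟨ sum-cong-≋ {n} (λ i → -‿distribʳ-* (v i) (b i)) ⟩
    ∑ {n} (λ i → v i * - b i)   ∎

  functional-∑ : ∀ {m n} {f : Fin m → Vector Carrier n → Carrier} →
                 (∀ i → Functional (f i)) → Functional {n} (λ v → ∑ {m} (λ i → f i v))
  functional-∑ {m} {n} {f} F = (λ j → ∑ {m} (λ i → b i j)) , λ v → begin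
    ∑ {m} (λ i → f i v)                         ≈⟨ sum-cong-≋ {m} (λ i → proj₂ (F i) v) ⟩
    ∑ {m} (λ i → ∑ {n} (λ j → v j * b i j))     ≈⟨ ∑-comm {m} {n} (λ i j → v j * b i j) ⟩
    ∑ {n} (λ j → ∑ {m} (λ i → v j * b i j))     ≈⟨ sum-cong-≋ {n} (λ j → sym (*-distribˡ-sum {m} (v j) (λ i → b i j))) ⟩
    ∑ {n} (λ j → v j * ∑ {m} (λ i → b i j))     ∎
    where
    b : Fin m → Vector Carrier n
    b i = proj₁ (F i)

  -- Exchanging two finite sums. The coefficient vector also makes `f` respect pointwise equality,
  -- so no congruence of `f` has to be assumed.
  functional-linearCombination :
    ∀ {m n} {f : Vector Carrier n → Carrier} → Functional f → ∀ a (b : Fin m → Vector Carrier n) →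
    f (linearCombination a b) ≈ ∑ {m} (λ i → a i * f (b i))
  functional-linearCombination {m} {n} {f} (w , f≈) a b = begin
    f (linearCombination a b)                           ≈⟨ f≈ _ ⟩
    ∑ {n} (λ j → ∑ {m} (λ i → a i * b i j) * w j)       ≈⟨ sum-cong-≋ {n} (λ j → *-distribʳ-sum {m} (w j) (λ i → a i * b i j)) ⟩
    ∑ {n} (λ j → ∑ {m} (λ i → a i * b i j * w j))       ≈⟨ ∑-comm {n} {m} (λ j i → a i * b i j * w j) ⟩
    ∑ {m} (λ i → ∑ {n} (λ j → a i * b i j * w j))       ≈⟨ sum-cong-≋ {m} (λ i → sum-cong-≋ {n} λ j → *-assoc (a i) (b i j) (w j)) ⟩
    ∑ {m} (λ i → ∑ {n} (λ j → a i * (b i j * w j)))     ≈⟨ sum-cong-≋ {m} (λ i → sym (*-distribˡ-sum {n} (a i) (λ j → b i j * w j))) ⟩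
    ∑ {m} (λ i → a i * ∑ {n} (λ j → b i j * w j))       ≈⟨ sum-cong-≋ {m} (λ i → *-congˡ (sym (f≈ (b i)))) ⟩
    ∑ {m} (λ i → a i * f (b i))                         ∎

  -- Combinations of any length are allowed at once, so that the condition applies directly to a
  -- partial sum over basis vectors.
  Closed : ∀ {n ℓ} → Pred (Vector Carrier n) ℓ → Set (c ⊔ ℓ)
  Closed {n} U = ∀ {m} a (b : Fin m → Vector Carrier n) → (∀ i → U (b i)) → U (linearCombination a b)

  -- Every closure proof for a subspace below goes back to this one, each being given by equations
  -- between functionals.
  closed-≈ : ∀ {n} {f g : Vector Carrier n → Carrier} → Functional f → Functional g →
             Closed {n} (λ v → f v ≈ g v)
  closed-≈ {f = f} {g} F G {m} a b f≈g = begin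
    f (linearCombination a b) ≈⟨ functional-linearCombination F a b ⟩
    ∑ {m} (λ i → a i * f (b i)) ≈⟨ sum-cong-≋ {m} (λ i → *-congˡ (f≈g i)) ⟩
    ∑ {m} (λ i → a i * g (b i)) ≈⟨ functional-linearCombination G a b ⟨
    g (linearCombination a b) ∎

  -- Dimension and direct sums

  -- The images of the standard basis vectors form the basis: by linearity `φ a` is their
  -- combination with coefficients `a`, so injectivity becomes independence and surjectivity becomes
  -- spanning.
  dimension-parametrised :
    ∀ {m n ℓ} {U : Pred (Vector Carrier n) ℓ} (φ : Vector Carrier m → Vector Carrier n) →
    (∀ j → Functional {m} (λ a → φ a j)) → (∀ a → U (φ a)) →
    (∀ a → (∀ j → φ a j ≈ 0#) → ∀ i → a i ≈ 0#) →
    (∀ v → U v → ∃[ a ] v ≋ φ a) → HasDimension U m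
  dimension-parametrised {m} {U = U} φ F Uφ injective surjective =
    b , (λ i → Uφ (δ i)) ,
    (λ a ab≈0 → injective a λ j → trans (φ≈ a j) (ab≈0 j)) ,
    λ v Uv → let a , v≈φa = surjective v Uv in a , λ j → trans (v≈φa j) (φ≈ a j)
    where
    b = λ i → φ (δ i)
    φ≈ : ∀ a → φ a ≋ linearCombination a b
    φ≈ a j = trans (proj₂ (F j) a)
      -- The `i`-th coefficient of a functional is its value at `δ i`.
      (sum-cong-≋ {m} λ i → *-congˡ (sym (trans (proj₂ (F j) (δ i)) (∑-δ i (proj₁ (F j))))))

  -- The inclusion of `W` in `U` is asked only up to `≋`, since a predicate on functions need not
  -- respect pointwise equality.
  dimension-resp : ∀ {n m ℓ ℓ′} {U : Pred (Vector Carrier n) ℓ} {W : Pred (Vector Carrier n) ℓ′} →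
                   (∀ v → U v → W v) → (∀ v → W v → ∃[ u ] U u × v ≋ u) → HasDimension U m → HasDimension W m
  dimension-resp U⊆W W⊆U (b , Ub , b-indep , b-span) = b , (λ i → U⊆W _ (Ub i)) , b-indep , λ v Wv →
    let u , Uu , v≋u = W⊆U v Wv
        a , u≋ab = b-span u Uu
    in a , λ j → trans (v≋u j) (u≋ab j)

  -- Expresses W = U ⊕ W′. A relation u + w = 0 has to force only u = 0, as w = 0 then follows.
  record DirectSum {n ℓ} (W U W′ : Pred (Vector Carrier n) ℓ) : Set (c ⊔ ℓ₁ ⊔ ℓ) where
    field
      closedˡ     : Closed U
      closedʳ     : Closed W′
      ⊆ˡ          : ∀ {v} → U v → W v
      ⊆ʳ          : ∀ {v} → W′ v → W v
      decompose   : ∀ v → W v → ∃[ u ] ∃[ w ] U u × W′ w × (∀ i → v i ≈ u i + w i)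
      independent : ∀ u w → U u → W′ w → (∀ i → u i + w i ≈ 0#) → ∀ i → u i ≈ 0#

    independentʳ : ∀ u w → U u → W′ w → (∀ i → u i + w i ≈ 0#) → ∀ i → w i ≈ 0#
    independentʳ u w Uu W′w u+w≈0 i =
      trans (trans (sym (+-identityˡ _)) (+-congʳ (sym (independent u w Uu W′w u+w≈0 i)))) (u+w≈0 i)

  dimension-⊕ : ∀ {n m k ℓ} {W U W′ : Pred (Vector Carrier n) ℓ} → DirectSum W U W′ →
                HasDimension U m → HasDimension W′ k → HasDimension W (m ℕ.+ k)
  dimension-⊕ {n} {m} {k} {W = W} {U} {W′} D (b , Ub , b-indep , b-span) (b′ , W′b′ , b′-indep , b′-span) =
    e , We , e-indep , e-span
    where
    open DirectSum D
    e : Fin (m ℕ.+ k) → Vector Carrier n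
    e i = [ b , b′ ]′ (splitAt m i)
    We : ∀ i → W (e i)
    We i with splitAt m i
    ... | inj₁ i₁ = ⊆ˡ (Ub i₁)
    ... | inj₂ i₂ = ⊆ʳ (W′b′ i₂)
    e-combination : ∀ a → linearCombination a e ≋
      (λ j → linearCombination (λ i → a (i ↑ˡ k)) b j + linearCombination (λ i → a (m ↑ʳ i)) b′ j)
    e-combination a j = trans (∑-↑ m (λ i → a i * e i j)) (+-cong
      (sum-cong-≋ {m} λ i → *-congˡ (reflexive (≡.cong (λ s → [ b , b′ ]′ s j) (splitAt-↑ˡ m i k))))
      (sum-cong-≋ {k} λ i → *-congˡ (reflexive (≡.cong (λ s → [ b , b′ ]′ s j) (splitAt-↑ʳ m k i)))))
    e-indep : LinearlyIndependent e
    e-indep a ae≈0 i = ≡.subst (λ i → a i ≈ 0#) (join-splitAt m k i) (case (splitAt m i))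
      where
      -- The relation is grouped into its `U` part and its `W′` part; each vanishes by itself, which
      -- reduces to the independence of the two given bases.
      u = linearCombination (λ i → a (i ↑ˡ k)) b
      w = linearCombination (λ i → a (m ↑ʳ i)) b′
      Uu : U u
      Uu = closedˡ _ b Ub
      W′w : W′ w
      W′w = closedʳ _ b′ W′b′
      u+w≈0 : ∀ j → u j + w j ≈ 0#
      u+w≈0 j = trans (sym (e-combination a j)) (ae≈0 j)
      case : ∀ s → a (join m k s) ≈ 0#
      case (inj₁ i) = b-indep _ (independent u w Uu W′w u+w≈0) i
      case (inj₂ i) = b′-indep _ (independentʳ u w Uu W′w u+w≈0) i
    e-span : ∀ v → W v → ∃[ a ] (∀ j → v j ≈ linearCombination a e j)
    e-span v Wv with decompose v Wv
    ... | u , w , Uu , W′w , v≈u+w with b-span u Uu | b′-span w W′w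
    ... | a , u≈ | a′ , w≈ = a″ , λ j → begin
      v j                                                   ≈⟨ v≈u+w j ⟩
      u j + w j                                             ≈⟨ +-cong (u≈ j) (w≈ j) ⟩
      linearCombination a b j + linearCombination a′ b′ j
        ≈⟨ +-cong (sum-cong-≋ {m} λ i → *-congʳ (reflexive (≡.cong [ a , a′ ]′ (≡.sym (splitAt-↑ˡ m i k)))))
                  (sum-cong-≋ {k} λ i → *-congʳ (reflexive (≡.cong [ a , a′ ]′ (≡.sym (splitAt-↑ʳ m k i))))) ⟩
      linearCombination (λ i → a″ (i ↑ˡ k)) b j + linearCombination (λ i → a″ (m ↑ʳ i)) b′ j
                                                            ≈⟨ e-combination a″ j ⟨
      linearCombination a″ e j                              ∎
      where
      a″ : Vector Carrier (m ℕ.+ k)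
      a″ i = [ a , a′ ]′ (splitAt m i)

  -- Diagonalisation by splitting off eigenspaces

  module Diagonalisation {n} (M : Matrix Carrier n) where

    infix 8 M*_
    M*_ : Vector Carrier n → Vector Carrier n
    (M* v) i = ∑ {n} (λ j → M i j * v j)

    functional-M : ∀ i → Functional {n} (λ v → (M* v) i)
    functional-M i = M i , λ v → sum-cong-≋ {n} λ j → *-comm (M i j) (v j)

    closed-Eigenspace : ∀ x → Closed (Eigenspace M x)
    closed-Eigenspace x a b Eb i =
      closed-≈ (functional-M i) (functional-*ˡ x (functional-coordinate i)) a b λ k → Eb k i

    -- The first condition of `HasSpectrum` relative to a subspace `W`. As `x` is arbitrary, it also
    -- excludes eigenvectors in `W` for values outside the symbol.
    Diagonal : Pred (Vector Carrier n) ℓ₁ → List (Carrier × ℕ) → Set (c ⊔ ℓ₁)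
    Diagonal W σ = ∀ x → HasDimension (W ∩ Eigenspace M x) (multiplicity σ x)

    diagonal-[] : ∀ {W} → (∀ v → W v → ∀ i → v i ≈ 0#) → Diagonal W []
    diagonal-[] W≈0 x = (λ ()) , (λ ()) , (λ _ _ ()) , λ v Wv → (λ ()) , W≈0 v (proj₁ Wv)

    M-+ : ∀ u w → M* (λ i → u i + w i) ≋ (λ i → (M* u) i + (M* w) i)
    M-+ u w i = trans (sum-cong-≋ {n} λ j → distribˡ (M i j) (u j) (w j)) (∑-distrib-+ {n} (λ j → M i j * u j) (λ j → M i j * w j))

    M-cong : ∀ {u w} → u ≋ w → M* u ≋ M* w
    M-cong u≋w i = sum-cong-≋ {n} λ j → *-congˡ (u≋w j)

    module _ {W U W′ : Pred (Vector Carrier n) ℓ₁} (D : DirectSum W U W′) {μ : Carrier}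
             (U⊆E : ∀ {u} → U u → Eigenspace M μ u) (invariant : ∀ {w} → W′ w → W′ (M* w)) where

      open DirectSum D

      -- (M − x) v = 0, split into its components (μ − x) u in U and (M − x) w in W′.
      shift : ∀ {x v u w} → Eigenspace M x v → U u → v ≋ (λ i → u i + w i) →
              ∀ i → (μ - x) * u i + ((M* w) i - x * w i) ≈ 0#
      shift {x} {v} {u} {w} Ev Uu v≋u+w i = begin
        (μ - x) * u i + ((M* w) i - x * w i)
          ≈⟨ solve 5 (λ μ x u w m → (μ :- x) :* u :+ (m :- x :* w) := μ :* u :+ m :- x :* (u :+ w))
               refl μ x (u i) (w i) ((M* w) i) ⟩
        μ * u i + (M* w) i - x * (u i + w i)        ≈⟨ +-congʳ (+-congʳ (U⊆E Uu i)) ⟨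
        (M* u) i + (M* w) i - x * (u i + w i)       ≈⟨ +-cong (M-+ u w i) (-‿cong (*-congˡ (v≋u+w i))) ⟨
        (M* (λ i → u i + w i)) i - x * v i          ≈⟨ +-congʳ (M-cong v≋u+w i) ⟨
        (M* v) i - x * v i                          ≈⟨ +-congʳ (Ev i) ⟩
        x * v i - x * v i                           ≈⟨ -‿inverseʳ _ ⟩
        0#                                          ∎

      -- For μ = x the `U` component in `shift` is 0, so (M - x)w = 0 and the `W′` component is
      -- itself an eigenvector.
      eigenspace-⊕ : ∀ {x} → μ ≈ x → DirectSum (W ∩ Eigenspace M x) U (W′ ∩ Eigenspace M x)
      eigenspace-⊕ {x} μ≈x = record
        { closedˡ     = closedˡ
        ; closedʳ     = λ a b UE → closedʳ a b (proj₁ ∘ UE) , closed-Eigenspace x a b (proj₂ ∘ UE)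
        ; ⊆ˡ          = λ Uu → ⊆ˡ Uu , λ i → trans (U⊆E Uu i) (*-congʳ μ≈x)
        ; ⊆ʳ          = λ (W′w , Ew) → ⊆ʳ W′w , Ew
        ; decompose   = λ v (Wv , Ev) →
            let u , w , Uu , W′w , v≋u+w = decompose v Wv
            in u , w , Uu , (W′w , λ i → x-y≈0⇒x≈y _ _ (begin
                 (M* w) i - x * w i                    ≈⟨ +-identityˡ _ ⟨
                 0# + ((M* w) i - x * w i)             ≈⟨ +-congʳ (zeroˡ _) ⟨
                 0# * u i + ((M* w) i - x * w i)       ≈⟨ +-congʳ (*-congʳ (trans (+-congʳ μ≈x) (-‿inverseʳ x))) ⟨
                 (μ - x) * u i + ((M* w) i - x * w i)  ≈⟨ shift Ev Uu v≋u+w i ⟩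
                 0#                                    ∎)) , v≋u+w
        ; independent = λ u w Uu W′w → independent u w Uu (proj₁ W′w)
        }

      -- Dividing `shift` by μ - x gives u + y(M - x)w = 0 with y the inverse of μ - x. The second
      -- summand lies in `W′` by invariance, so independence kills u.
      eigenspace-⊆ : ∀ {x} → ¬ (μ ≈ x) → ∀ v → (W ∩ Eigenspace M x) v →
                     ∃[ w ] (W′ ∩ Eigenspace M x) w × v ≋ w
      eigenspace-⊆ {x} μ≉x v (Wv , Ev) with decompose v Wv | invertible μ≉x
      ... | u , w , Uu , W′w , v≋u+w | y , y[μ-x]≈1 =
        w , (W′w , λ i → trans (sym (M-cong v≋w i)) (trans (Ev i) (*-congˡ (v≋w i)))) , v≋w
        where
        w₁ : Fin 2 → Vector Carrier n
        w₁ zero    = M* w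
        w₁ (suc _) = w
        -- The coefficients y and -yx write y(M - x)w as a combination of Mw and w, so that
        -- `closedʳ` applies.
        a : Vector Carrier 2
        a zero    = y
        a (suc _) = - (y * x)
        W′w₁ : ∀ i → W′ (w₁ i)
        W′w₁ zero    = invariant W′w
        W′w₁ (suc _) = W′w
        u+w₂≈0 : ∀ i → u i + linearCombination a w₁ i ≈ 0#
        u+w₂≈0 i = begin
          u i + (y * (M* w) i + (- (y * x) * w i + 0#))
            ≈⟨ solve 5 (λ u y x w m → u :+ (y :* m :+ (:- (y :* x) :* w :+ con (+ 0))) := con (+ 1) :* u :+ y :* (m :- x :* w))
                 refl (u i) y x (w i) ((M* w) i) ⟩
          ι (+ 1) * u i + y * ((M* w) i - x * w i)      ≈⟨ +-congʳ (*-congʳ (trans y[μ-x]≈1 1≈ι1)) ⟨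
          y * (μ - x) * u i + y * ((M* w) i - x * w i)  ≈⟨ trans (+-congʳ (*-assoc _ _ _)) (sym (distribˡ _ _ _)) ⟩
          y * ((μ - x) * u i + ((M* w) i - x * w i))    ≈⟨ *-congˡ (shift Ev Uu v≋u+w i) ⟩
          y * 0#                                        ≈⟨ zeroʳ y ⟩
          0#                                            ∎
        u≈0 : ∀ i → u i ≈ 0#
        u≈0 = independent u _ Uu (closedʳ a w₁ W′w₁) u+w₂≈0
        v≋w : v ≋ w
        v≋w i = trans (v≋u+w i) (trans (+-congʳ (u≈0 i)) (+-identityˡ _))

      diagonal-∷ : ∀ {m σ} → HasDimension U m → Diagonal W′ σ → Diagonal W ((μ , m) ∷ σ)
      -- `multiplicity` makes the same test on the head of the symbol, so it reduces in each branch
      -- to the dimension found there.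
      diagonal-∷ dimU diagW′ x with μ ≈? x
      ... | yes μ≈x = dimension-⊕ (eigenspace-⊕ μ≈x) dimU (diagW′ x)
      ... | no  μ≉x = dimension-resp (λ v (W′v , Ev) → ⊆ʳ W′v , Ev) (eigenspace-⊆ μ≉x) (diagW′ x)

-- Integer identities for the discriminant and the vertex count

-- For negative `i` the square already computes to a successor. For `+ a`, which may be 0, the
-- successor is taken from the second summand.
i²+4c-positive : ∀ i c → ∃[ m ] i ℤ.* i ℤ.+ + 4 ℤ.* + suc c ≡ + suc m
i²+4c-positive (+ a)    c = _ , ≡.trans
  (≡.cong (ℤ._+ + 4 ℤ.* + suc c) (≡.sym (ℤ.pos-* a a))) (≡.cong +_ (ℕ.+-suc (a ℕ.* a) _))
i²+4c-positive -[1+ a ] c = _ , ≡.refl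

-- With n = p + 2 and k = q + 2, the left side is the sum of the multiplicities, bracketed as the
-- list sum computes it.
vertex-count : ∀ p q → suc p ℕ.* q ℕ.+ (p ℕ.+ 2) ≡ suc (suc p ℕ.* suc q)
vertex-count = solve-∀

-- Roots of the quadratic

module Quadratic {c ℓ₁ ℓ₂} (K : HeytingField c ℓ₁ ℓ₂)
                 (_#?_ : Decidable (HeytingField._#_ K)) where
  open FieldProperties K _#?_

  -- The discriminant i² + 4m is a positive integer.
  no-double-root : CharacteristicZero → ∀ i m r → r + r ≈ ι i → ¬ (r * r ≈ - ι (+ suc m))
  no-double-root char0 i m r r+r≈ r*r≈ with i²+4c-positive i m
  ... | d , i²+4m≡ = char0 d (begin
    ι (+ suc d)                                ≡⟨ ≡.cong ι i²+4m≡ ⟨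
    ι (i ℤ.* i ℤ.+ + 4 ℤ.* + suc m)            ≈⟨ ι-homo-+ (i ℤ.* i) _ ⟩
    ι (i ℤ.* i) + ι (+ 4 ℤ.* + suc m)          ≈⟨ +-cong (ι-homo-* i i) (ι-homo-* (+ 4) (+ suc m)) ⟩
    ι i * ι i + ι (+ 4) * ι (+ suc m)          ≈⟨ +-cong (*-cong r+r≈ r+r≈) (*-congˡ (trans (-‿cong r*r≈) (-‿involutive _))) ⟨
    (r + r) * (r + r) + ι (+ 4) * (- (r * r))
      ≈⟨ solve 1 (λ r → (r :+ r) :* (r :+ r) :+ con (+ 4) :* (:- (r :* r)) := con (+ 0)) refl r ⟩
    0#                                         ∎)

  -- If r₁ is a root then so is s − r₁.
  vieta : ∀ s m r₁ r₂ → (∀ r → r + r ≈ s → ¬ (r * r ≈ - m)) →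
          (∀ x → (x * x - s * x - m ≈ 0#) ⇔ (x ≈ r₁ ⊎ x ≈ r₂)) →
          r₁ + r₂ ≈ s × r₁ * r₂ ≈ - m × ¬ (r₁ ≈ r₂)
  vieta s m r₁ r₂ no-double roots = case (Equivalence.to (roots (s - r₁)) s-r₁-root)
    where
    r₁-root : r₁ * r₁ - s * r₁ - m ≈ 0#
    r₁-root = Equivalence.from (roots r₁) (inj₁ refl)
    s-r₁-root : (s - r₁) * (s - r₁) - s * (s - r₁) - m ≈ 0#
    s-r₁-root = trans
      (solve 3 (λ s m r → (s :- r) :* (s :- r) :- s :* (s :- r) :- m := r :* r :- s :* r :- m) refl s m r₁)
      r₁-root
    sum⇒product : ∀ r → r₁ + r ≈ s → r₁ * r ≈ - m
    sum⇒product r r₁+r≈s = x-y≈0⇒x≈y _ _ (begin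
      r₁ * r - - m
        ≈⟨ solve 3 (λ r₁ r m → r₁ :* r :- :- m := :- (r₁ :* r₁ :- (r₁ :+ r) :* r₁ :- m)) refl r₁ r m ⟩
      - (r₁ * r₁ - (r₁ + r) * r₁ - m) ≈⟨ -‿cong (+-congʳ (+-congˡ (-‿cong (*-congʳ r₁+r≈s)))) ⟩
      - (r₁ * r₁ - s * r₁ - m)        ≈⟨ -‿cong r₁-root ⟩
      - 0#                            ≈⟨ -0#≈0# ⟩
      0#                              ∎)
    complement : ∀ {r} → s - r₁ ≈ r → r₁ + r ≈ s
    complement {r} s-r₁≈r = begin
      r₁ + r          ≈⟨ +-congˡ s-r₁≈r ⟨
      r₁ + (s - r₁)   ≈⟨ solve 2 (λ r s → r :+ (s :- r) := s) refl r₁ s ⟩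
      s               ∎
    case : s - r₁ ≈ r₁ ⊎ s - r₁ ≈ r₂ → _
    -- Here r₁ would satisfy 2r₁ = s and r₁² = -m, so it would be a double root. The same
    -- contradiction shows r₁ ≠ r₂ in the other case.
    case (inj₁ eq) = contradiction (sum⇒product r₁ (complement eq)) (no-double r₁ (complement eq))
    case (inj₂ eq) = complement eq , sum⇒product r₂ (complement eq) , λ r₁≈r₂ →
      let r₁+r₁≈s = trans (+-congˡ r₁≈r₂) (complement eq)
      in no-double r₁ r₁+r₁≈s (sum⇒product r₁ r₁+r₁≈s)

-- The Seidel operator in leaf coordinates

module HyperstarSpectrum {c ℓ₁ ℓ₂} (K : HeytingField c ℓ₁ ℓ₂)
                 (_#?_ : Decidable (HeytingField._#_ K)) (p q : ℕ) (0<q : 0 < suc q) where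
  open FieldProperties K _#?_

  private
    N = starOrder (suc p) (suc q)
    o = centre (suc p) (suc q)
    ℓ = leaf (suc p) (suc q)

  -- The images in K of n - 1 and k - 1. In this module `p` and `q` are n - 2 and k - 2, so both
  -- counts are successors.
  P Q : Carrier
  P = ι (+ suc p)
  Q = ι (+ suc q)

  S : Matrix Carrier N
  S i j = ι (seidel (hyperstar (suc (suc p)) (suc (suc q)) (s≤s 0<q)) i j)

  open Diagonalisation S

  edgeSum : Vector Carrier N → Fin (suc p) → Carrier
  edgeSum v i = ∑ {suc q} (λ j → v (ℓ i j))

  total : Vector Carrier N → Carrier
  total v = ∑ {suc p} (λ i → edgeSum v i)

  ∑-vertices : ∀ v → ∑ {N} v ≈ v o + total v
  ∑-vertices v = +-congˡ (∑-combine (suc p) (suc q) (v ∘ suc))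

  functional-edgeSum : ∀ i → Functional {N} (λ v → edgeSum v i)
  functional-edgeSum i = functional-∑ λ j → functional-coordinate (ℓ i j)

  functional-total : Functional total
  functional-total = functional-∑ functional-edgeSum

  -- The leaf block is J - 2B + I, where B marks pairs of leaves in the same edge: its values are 0
  -- for equal leaves, -1 within an edge and 1 across edges.
  S-leaf-leaf : ∀ i j i′ j′ → S (ℓ i j) (ℓ i′ j′) ≈ ι (+ 1) - ι (+ 2) * δ i i′ + δ i i′ * δ j j′
  S-leaf-leaf i j i′ j′ with i ≟ i′ | j ≟ j′
  ... | yes ≡.refl | yes ≡.refl = trans (reflexive (≡.cong ι (seidel-diagonal {suc p} 0<q (ℓ i j))))
    (sym (trans (+-cong (+-congˡ (-‿cong (*-congˡ 1≈ι1))) (*-cong 1≈ι1 1≈ι1))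
      (solve 0 (con (+ 1) :- con (+ 2) :* con (+ 1) :+ con (+ 1) :* con (+ 1) := con (+ 0)) refl)))
  ... | yes ≡.refl | no  j≢j′   = trans (reflexive (≡.cong ι (seidel-same-edge {suc p} 0<q i j≢j′)))
    (sym (trans (+-cong (+-congˡ (-‿cong (*-congˡ 1≈ι1))) (*-congʳ 1≈ι1))
      (solve 0 (con (+ 1) :- con (+ 2) :* con (+ 1) :+ con (+ 1) :* con (+ 0) := con -[1+ 0 ]) refl)))
  ... | no  i≢i′   | yes _      = trans (reflexive (≡.cong ι (seidel-distinct-edges {suc p} 0<q j j′ i≢i′)))
    -- Here `δ j j′` is `1#`, which is no solver literal; it enters as a variable with coefficient
    -- 0.
    (sym (solve 1 (λ x → con (+ 1) :- con (+ 2) :* con (+ 0) :+ con (+ 0) :* x := con (+ 1)) refl 1#))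
  ... | no  i≢i′   | no  _      = trans (reflexive (≡.cong ι (seidel-distinct-edges {suc p} 0<q j j′ i≢i′)))
    (sym (solve 0 (con (+ 1) :- con (+ 2) :* con (+ 0) :+ con (+ 0) :* con (+ 0) := con (+ 1)) refl))

  S*-centre : ∀ v → (M* v) o ≈ - total v
  S*-centre v = begin
    ∑ {N} (λ x → S o x * v x)
      ≈⟨ ∑-vertices (λ x → S o x * v x) ⟩
    S o o * v o + ∑ {suc p} (λ i → ∑ {suc q} (λ j → S o (ℓ i j) * v (ℓ i j)))
      ≈⟨ +-cong (trans (*-congʳ (reflexive (≡.cong ι (seidel-diagonal {suc p} 0<q o)))) (zeroˡ (v o)))
                (sum-cong-≋ {suc p} λ i → sum-cong-≋ {suc q} λ j → trans
                  (*-congʳ (reflexive (≡.cong ι (seidel-centre-leaf {suc p} 0<q i j))))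
                  (solve 1 (λ x → con -[1+ 0 ] :* x := :- x) refl (v (ℓ i j)))) ⟩
    0# + ∑ {suc p} (λ i → ∑ {suc q} (λ j → - v (ℓ i j)))
      ≈⟨ +-identityˡ _ ⟩
    ∑ {suc p} (λ i → ∑ {suc q} (λ j → - v (ℓ i j)))
      ≈⟨ sum-cong-≋ {suc p} (λ i → ∑-neg {suc q} (λ j → v (ℓ i j))) ⟩
    ∑ {suc p} (λ i → - edgeSum v i)
      ≈⟨ ∑-neg {suc p} (edgeSum v) ⟩
    - total v ∎

  -- Each edge contributes its edge sum, and a delta attaches the correction x - 2e to edge `i`
  -- only; `∑-δ` collects it.
  S*-leaf : ∀ v i j → (M* v) (ℓ i j) ≈ total v - ι (+ 2) * edgeSum v i - v o + v (ℓ i j)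
  S*-leaf v i j = begin
    ∑ {N} (λ x → S (ℓ i j) x * v x)
      ≈⟨ ∑-vertices (λ x → S (ℓ i j) x * v x) ⟩
    S (ℓ i j) o * v o + ∑ {suc p} (λ i′ → ∑ {suc q} (λ j′ → S (ℓ i j) (ℓ i′ j′) * v (ℓ i′ j′)))
      ≈⟨ +-cong (*-congʳ (reflexive (≡.cong ι (seidel-leaf-centre {suc p} 0<q i j)))) (sum-cong-≋ {suc p} edge) ⟩
    ι -[1+ 0 ] * v o + ∑ {suc p} (λ i′ → edgeSum v i′ + δ i i′ * (v (ℓ i′ j) - ι (+ 2) * edgeSum v i′))
      ≈⟨ +-congˡ (∑-distrib-+ {suc p} (edgeSum v) (λ i′ → δ i i′ * (v (ℓ i′ j) - ι (+ 2) * edgeSum v i′))) ⟩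
    ι -[1+ 0 ] * v o + (total v + ∑ {suc p} (λ i′ → δ i i′ * (v (ℓ i′ j) - ι (+ 2) * edgeSum v i′)))
      ≈⟨ +-congˡ (+-congˡ (∑-δ i (λ i′ → v (ℓ i′ j) - ι (+ 2) * edgeSum v i′))) ⟩
    ι -[1+ 0 ] * v o + (total v + (v (ℓ i j) - ι (+ 2) * edgeSum v i))
      ≈⟨ solve 4 (λ c t e x → con -[1+ 0 ] :* c :+ (t :+ (x :- con (+ 2) :* e)) := t :- con (+ 2) :* e :- c :+ x)
           refl (v o) (total v) (edgeSum v i) (v (ℓ i j)) ⟩
    total v - ι (+ 2) * edgeSum v i - v o + v (ℓ i j) ∎
    where
    edge : ∀ i′ → ∑ {suc q} (λ j′ → S (ℓ i j) (ℓ i′ j′) * v (ℓ i′ j′)) ≈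
                  edgeSum v i′ + δ i i′ * (v (ℓ i′ j) - ι (+ 2) * edgeSum v i′)
    edge i′ = begin
      ∑ {suc q} (λ j′ → S (ℓ i j) (ℓ i′ j′) * v (ℓ i′ j′))
        ≈⟨ sum-cong-≋ {suc q} (λ j′ → trans (*-congʳ (S-leaf-leaf i j i′ j′))
             (solve 4 (λ a d e x → (a :+ d :* e) :* x := a :* x :+ d :* (e :* x)) refl a (δ i i′) (δ j j′) (v (ℓ i′ j′)))) ⟩
      ∑ {suc q} (λ j′ → a * v (ℓ i′ j′) + δ i i′ * (δ j j′ * v (ℓ i′ j′)))
        ≈⟨ ∑-distrib-+ {suc q} (λ j′ → a * v (ℓ i′ j′)) (λ j′ → δ i i′ * (δ j j′ * v (ℓ i′ j′))) ⟩
      ∑ {suc q} (λ j′ → a * v (ℓ i′ j′)) + ∑ {suc q} (λ j′ → δ i i′ * (δ j j′ * v (ℓ i′ j′)))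
        ≈⟨ +-cong (*-distribˡ-sum {suc q} a (λ j′ → v (ℓ i′ j′))) (*-distribˡ-sum {suc q} (δ i i′) (λ j′ → δ j j′ * v (ℓ i′ j′))) ⟨
      a * edgeSum v i′ + δ i i′ * ∑ {suc q} (λ j′ → δ j j′ * v (ℓ i′ j′))
        ≈⟨ +-congˡ (*-congˡ (∑-δ j (λ j′ → v (ℓ i′ j′)))) ⟩
      a * edgeSum v i′ + δ i i′ * v (ℓ i′ j)
        ≈⟨ solve 3 (λ d e x → (con (+ 1) :- con (+ 2) :* d) :* e :+ d :* x := con (+ 1) :* e :+ d :* (x :- con (+ 2) :* e))
             refl (δ i i′) (edgeSum v i′) (v (ℓ i′ j)) ⟩
      ι (+ 1) * edgeSum v i′ + δ i i′ * (v (ℓ i′ j) - ι (+ 2) * edgeSum v i′)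
        ≈⟨ +-congʳ (trans (*-congʳ (sym 1≈ι1)) (*-identityˡ _)) ⟩
      edgeSum v i′ + δ i i′ * (v (ℓ i′ j) - ι (+ 2) * edgeSum v i′) ∎
      where
      a : Carrier
      a = ι (+ 1) - ι (+ 2) * δ i i′

  -- The subspaces, their eigenvalues and their invariance

  private
    infixl 6 _⊞_
    _⊞_ : Vector Carrier N → Vector Carrier N → Vector Carrier N
    (u ⊞ w) i = u i + w i

  -- The splittings are K^N = U₀ ⊕ W₁ and W₁ = U₁ ⊕ W₂. The centre value is free in `W₁` and `W₂`,
  -- and the first leaf serves as the reference value.
  U₀ W₁ U₁ W₂ : Pred (Vector Carrier N) ℓ₁
  U₀ v = v o ≈ 0# × (∀ i → edgeSum v i ≈ 0#)
  W₁ v = ∀ i j → v (ℓ i j) ≈ v (ℓ i zero)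
  U₁ v = W₁ v × v o ≈ 0# × total v ≈ 0#
  W₂ v = ∀ i j → v (ℓ i j) ≈ v (ℓ zero zero)

  -- For the two roots r and r′ of the quadratic, Line r′ is the eigenline of r.
  Line : Carrier → Pred (Vector Carrier N) ℓ₁
  Line r v = W₂ v × v o ≈ r * v (ℓ zero zero)

  Null : Pred (Vector Carrier N) ℓ₁
  Null v = ∀ x → v x ≈ 0#

  closed-U₀ : Closed U₀
  closed-U₀ a b U =
    closed-≈ (functional-coordinate o) functional-0 a b (proj₁ ∘ U) ,
    λ i → closed-≈ (functional-edgeSum i) functional-0 a b λ k → proj₂ (U k) i

  closed-W₁ : Closed W₁
  closed-W₁ a b W i j =
    closed-≈ (functional-coordinate (ℓ i j)) (functional-coordinate (ℓ i zero)) a b λ k → W k i j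

  closed-U₁ : Closed U₁
  closed-U₁ a b U = closed-W₁ a b (proj₁ ∘ U) ,
    closed-≈ (functional-coordinate o) functional-0 a b (proj₁ ∘ proj₂ ∘ U) ,
    closed-≈ functional-total functional-0 a b (proj₂ ∘ proj₂ ∘ U)

  closed-W₂ : Closed W₂
  closed-W₂ a b W i j =
    closed-≈ (functional-coordinate (ℓ i j)) (functional-coordinate (ℓ zero zero)) a b λ k → W k i j

  closed-Line : ∀ r → Closed (Line r)
  closed-Line r a b L = closed-W₂ a b (proj₁ ∘ L) ,
    closed-≈ (functional-coordinate o) (functional-*ˡ r (functional-coordinate (ℓ zero zero))) a b (proj₂ ∘ L)

  closed-Null : Closed Null
  closed-Null a b Z x = closed-≈ (functional-coordinate x) functional-0 a b λ k → Z k x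

  W₂⊆W₁ : ∀ v → W₂ v → W₁ v
  W₂⊆W₁ v W i j = trans (W i j) (sym (W i zero))

  edgeSum-W₁ : ∀ v → W₁ v → ∀ i → edgeSum v i ≈ Q * v (ℓ i zero)
  edgeSum-W₁ v W i = ∑-const {suc q} (W i)

  total-W₂ : ∀ v → W₂ v → total v ≈ P * (Q * v (ℓ zero zero))
  total-W₂ v W = ∑-const {suc p} λ i → trans (edgeSum-W₁ v (W₂⊆W₁ v W) i) (*-congˡ (W i zero))

  edgeSum-+ : ∀ u w i → edgeSum (u ⊞ w) i ≈ edgeSum u i + edgeSum w i
  edgeSum-+ u w i = ∑-distrib-+ {suc q} (λ j → u (ℓ i j)) (λ j → w (ℓ i j))

  total-+ : ∀ u w → total (u ⊞ w) ≈ total u + total w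
  total-+ u w = trans (sum-cong-≋ {suc p} (edgeSum-+ u w)) (∑-distrib-+ {suc p} (edgeSum u) (edgeSum w))

  assemble-≈ : ∀ (x : Carrier) g i j → assemble x g (ℓ i j) ≈ g i j
  assemble-≈ x g i j = reflexive (assemble-leaf x g i j)

  edgeSum-assemble : ∀ x g i → edgeSum (assemble x g) i ≈ ∑ {suc q} (g i)
  edgeSum-assemble x g i = sum-cong-≋ {suc q} λ j → assemble-≈ x g i j

  total-assemble : ∀ x g → total (assemble x g) ≈ ∑ {suc p} (λ i → ∑ {suc q} (g i))
  total-assemble x g = sum-cong-≋ {suc p} (edgeSum-assemble x g)

  functional-assemble : ∀ {m} {f : Vector Carrier m → Carrier} {g : Vector Carrier m → Fin (suc p) → Fin (suc q) → Carrier} →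
    Functional f → (∀ i j → Functional {m} (λ a → g a i j)) →
    ∀ x → Functional {m} (λ a → assemble (f a) (g a) x)
  functional-assemble F G zero    = F
  functional-assemble F G (suc y) = uncurry G (remQuot {suc p} (suc q) y)

  eigenspace-leafwise : ∀ x v → - total v ≈ x * v o →
    (∀ i j → total v - ι (+ 2) * edgeSum v i - v o + v (ℓ i j) ≈ x * v (ℓ i j)) →
    Eigenspace S x v
  eigenspace-leafwise x v c l = ∀-vertex {suc p} (λ y → (M* v) y ≈ x * v y)
    (trans (S*-centre v) c) λ i j → trans (S*-leaf v i j) (l i j)

  total-U₀ : ∀ v → U₀ v → total v ≈ 0#
  total-U₀ v U = ∑-zero {suc p} (proj₂ U)

  U₀⊆E : ∀ {v} → U₀ v → Eigenspace S (ι (+ 1)) v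
  U₀⊆E {v} U = eigenspace-leafwise (ι (+ 1)) v
    (begin
      - total v    ≈⟨ -‿cong (total-U₀ v U) ⟩
      - 0#         ≈⟨ solve 0 (:- con (+ 0) := con (+ 1) :* con (+ 0)) refl ⟩
      ι (+ 1) * 0# ≈⟨ *-congˡ (proj₁ U) ⟨
      ι (+ 1) * v o ∎)
    λ i j → trans
      (+-congʳ (+-cong (+-cong (total-U₀ v U) (-‿cong (*-congˡ (proj₂ U i)))) (-‿cong (proj₁ U))))
      (solve 1 (λ x → con (+ 0) :- con (+ 2) :* con (+ 0) :- con (+ 0) :+ x := con (+ 1) :* x) refl (v (ℓ i j)))

  -- On an edge with constant value x the edge sum is Qx, so x is mapped to (1 - 2Q)x, and 1 - 2Q =
  -- 3 - 2k because Q = k - 1.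
  U₁⊆E : ∀ {v} → U₁ v → Eigenspace S (ι (+ 3 ℤ.- + 2 ℤ.* + suc (suc q))) v
  U₁⊆E {v} (W , v₀≈0 , T≈0) = eigenspace-leafwise _ v
    (begin
      - total v    ≈⟨ -‿cong T≈0 ⟩
      - 0#         ≈⟨ -0#≈0# ⟩
      0#           ≈⟨ zeroʳ _ ⟨
      _ * 0#       ≈⟨ *-congˡ v₀≈0 ⟨
      _ * v o      ∎)
    λ i j → begin
      total v - ι (+ 2) * edgeSum v i - v o + v (ℓ i j)
        ≈⟨ +-congʳ (+-cong (+-cong T≈0 (-‿cong (*-congˡ (trans (edgeSum-W₁ v W i) (*-congˡ (sym (W i j))))))) (-‿cong v₀≈0)) ⟩
      0# - ι (+ 2) * (Q * v (ℓ i j)) - 0# + v (ℓ i j)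
        ≈⟨ solve 2 (λ Q x → con (+ 0) :- con (+ 2) :* (Q :* x) :- con (+ 0) :+ x := (con (+ 3) :- con (+ 2) :* (con (+ 1) :+ Q)) :* x)
             refl Q (v (ℓ i j)) ⟩
      (ι (+ 3) - ι (+ 2) * (ι (+ 1) + Q)) * v (ℓ i j)
        ≈⟨ *-congʳ eigenvalue ⟨
      _ * v (ℓ i j) ∎
    where
    eigenvalue : ι (+ 3 ℤ.- + 2 ℤ.* + suc (suc q)) ≈ ι (+ 3) - ι (+ 2) * (ι (+ 1) + Q)
    eigenvalue = trans (ι-homo-- (+ 3) (+ 2 ℤ.* + suc (suc q)))
      (+-congˡ (-‿cong (trans (ι-homo-* (+ 2) (+ suc (suc q))) (*-congˡ (ι-homo-+ (+ 1) (+ suc q))))))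

  -- With leaf value t and centre value r′t, the centre row gives -PQt = r(r′t) by the product of
  -- the roots. A leaf row gives (Q(P - 2) + 1 - r′)t = rt by their sum.
  Line⊆E : ∀ {r r′} → r + r′ ≈ Q * (P - ι (+ 2)) + ι (+ 1) → r * r′ ≈ - (P * Q) →
           ∀ {v} → Line r′ v → Eigenspace S r v
  Line⊆E {r} {r′} r+r′ rr′ {v} (W , v₀≈) = eigenspace-leafwise r v
    (begin
      - total v          ≈⟨ -‿cong (total-W₂ v W) ⟩
      - (P * (Q * t))    ≈⟨ solve 3 (λ P Q t → :- (P :* (Q :* t)) := :- (P :* Q) :* t) refl P Q t ⟩
      - (P * Q) * t      ≈⟨ *-congʳ rr′ ⟨
      r * r′ * t         ≈⟨ *-assoc r r′ t ⟩
      r * (r′ * t)       ≈⟨ *-congˡ v₀≈ ⟨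
      r * v o            ∎)
    λ i j → begin
      total v - ι (+ 2) * edgeSum v i - v o + v (ℓ i j)
        ≈⟨ +-cong (+-cong (+-cong (total-W₂ v W)
             (-‿cong (*-congˡ (trans (edgeSum-W₁ v (W₂⊆W₁ v W) i) (*-congˡ (W i zero)))))) (-‿cong v₀≈)) (W i j) ⟩
      P * (Q * t) - ι (+ 2) * (Q * t) - r′ * t + t
        ≈⟨ solve 4 (λ P Q r t → P :* (Q :* t) :- con (+ 2) :* (Q :* t) :- r :* t :+ t := (Q :* (P :- con (+ 2)) :+ con (+ 1) :- r) :* t)
             refl P Q r′ t ⟩
      (Q * (P - ι (+ 2)) + ι (+ 1) - r′) * t
        ≈⟨ *-congʳ (+-congʳ r+r′) ⟨
      (r + r′ - r′) * t
        ≈⟨ *-cong (solve 2 (λ r s → r :+ s :- s := r) refl r r′) (sym (W i j)) ⟩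
      r * v (ℓ i j) ∎
    where
    t = v (ℓ zero zero)

  invariant-W₁ : ∀ {v} → W₁ v → W₁ (M* v)
  invariant-W₁ {v} W i j = begin
    (M* v) (ℓ i j)                                        ≈⟨ S*-leaf v i j ⟩
    total v - ι (+ 2) * edgeSum v i - v o + v (ℓ i j)     ≈⟨ +-congˡ (W i j) ⟩
    total v - ι (+ 2) * edgeSum v i - v o + v (ℓ i zero)  ≈⟨ S*-leaf v i zero ⟨
    (M* v) (ℓ i zero)                                     ∎

  invariant-W₂ : ∀ {v} → W₂ v → W₂ (M* v)
  invariant-W₂ {v} W i j = begin
    (M* v) (ℓ i j)                                                ≈⟨ S*-leaf v i j ⟩
    total v - ι (+ 2) * edgeSum v i - v o + v (ℓ i j)             ≈⟨ +-cong (+-congʳ (+-congˡ (-‿cong (*-congˡ edges)))) (W i j) ⟩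
    total v - ι (+ 2) * edgeSum v zero - v o + v (ℓ zero zero)    ≈⟨ S*-leaf v zero zero ⟨
    (M* v) (ℓ zero zero)                                          ∎
    where
    edges : edgeSum v i ≈ edgeSum v zero
    edges = trans (edgeSum-W₁ v (W₂⊆W₁ v W) i) (trans (*-congˡ (W i zero)) (sym (edgeSum-W₁ v (W₂⊆W₁ v W) zero)))

  invariant-Line : ∀ {r r′} → (∀ {v} → Line r′ v → Eigenspace S r v) → ∀ {v} → Line r′ v → Line r′ (M* v)
  invariant-Line {r} {r′} L⊆E {v} L@(W , v₀≈) = invariant-W₂ {v} W , (begin
    (M* v) o                 ≈⟨ L⊆E {v} L o ⟩
    r * v o                  ≈⟨ *-congˡ v₀≈ ⟩
    r * (r′ * v (ℓ zero zero)) ≈⟨ solve 3 (λ r s x → r :* (s :* x) := s :* (r :* x)) refl r r′ (v (ℓ zero zero)) ⟩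
    r′ * (r * v (ℓ zero zero)) ≈⟨ *-congˡ (L⊆E {v} L (ℓ zero zero)) ⟨
    r′ * (M* v) (ℓ zero zero) ∎)

  invariant-Null : ∀ {v} → Null v → Null (M* v)
  invariant-Null {v} Z i = ∑-zero {N} λ j → trans (*-congˡ (Z j)) (zeroʳ (S i j))

  -- Direct sum decompositions

  -- What is left of `v` once its centre value and the leaf values `g` are removed; its centre value
  -- is 0, as `U₀` and `U₁` require.
  remainder : Vector Carrier N → (Fin (suc p) → Fin (suc q) → Carrier) → Vector Carrier N
  remainder v g = assemble 0# (λ i j → v (ℓ i j) - g i j)

  remainder-+ : ∀ v g → v ≋ (remainder v g ⊞ assemble (v o) g)
  remainder-+ v g = ∀-vertex {suc p} (λ x → v x ≈ (remainder v g ⊞ assemble (v o) g) x)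
    (sym (+-identityˡ (v o)))
    λ i j → sym (trans (+-cong (assemble-≈ 0# (λ i j → v (ℓ i j) - g i j) i j) (assemble-≈ (v o) g i j))
      (solve 2 (λ x g → x :- g :+ g := x) refl (v (ℓ i j)) (g i j)))

  edgeSum-remainder : ∀ v g i → edgeSum (remainder v g) i ≈ edgeSum v i - ∑ {suc q} (g i)
  edgeSum-remainder v g i = begin
    edgeSum (remainder v g) i                      ≈⟨ edgeSum-assemble 0# (λ i j → v (ℓ i j) - g i j) i ⟩
    ∑ {suc q} (λ j → v (ℓ i j) - g i j)            ≈⟨ ∑-distrib-+ {suc q} (λ j → v (ℓ i j)) (λ j → - g i j) ⟩
    edgeSum v i + ∑ {suc q} (λ j → - g i j)        ≈⟨ +-congˡ (∑-neg {suc q} (g i)) ⟩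
    edgeSum v i - ∑ {suc q} (g i)                  ∎

  total-remainder : ∀ v g → total (remainder v g) ≈ total v - ∑ {suc p} (λ i → ∑ {suc q} (g i))
  total-remainder v g = begin
    total (remainder v g)                                         ≈⟨ sum-cong-≋ {suc p} (edgeSum-remainder v g) ⟩
    ∑ {suc p} (λ i → edgeSum v i - ∑ {suc q} (g i))               ≈⟨ ∑-distrib-+ {suc p} (edgeSum v) (λ i → - ∑ {suc q} (g i)) ⟩
    total v + ∑ {suc p} (λ i → - ∑ {suc q} (g i))                 ≈⟨ +-congˡ (∑-neg {suc p} (λ i → ∑ {suc q} (g i))) ⟩
    total v - ∑ {suc p} (λ i → ∑ {suc q} (g i))                   ∎

  vanish : ∀ u w → (∀ x → (u ⊞ w) x ≈ 0#) → u o ≈ 0# → (∀ i j → w (ℓ i j) ≈ 0#) → ∀ x → u x ≈ 0#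
  vanish u w u+w≈0 uo≈0 w≈0 = ∀-vertex {suc p} (λ x → u x ≈ 0#) uo≈0 λ i j →
    trans (trans (sym (+-identityʳ _)) (+-congˡ (sym (w≈0 i j)))) (u+w≈0 (ℓ i j))

  directSum₀ : ¬ (Q ≈ 0#) → DirectSum (λ v → v ≋ v) U₀ W₁
  directSum₀ Q≉0 = record
    { closedˡ = closed-U₀
    ; closedʳ = closed-W₁
    ; ⊆ˡ = λ _ _ → refl
    ; ⊆ʳ = λ _ _ → refl
    -- The value of `g` on edge `i` is the average of `v` over that edge, so the remainder has zero
    -- edge sums.
    ; decompose = λ v _ → let g = λ i _ → proj₁ (divide Q≉0 (edgeSum v i)) in
        remainder v g , assemble (v o) g ,
        (refl , λ i → begin
          edgeSum (remainder v g) i        ≈⟨ edgeSum-remainder v g i ⟩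
          edgeSum v i - ∑ {suc q} (g i)    ≈⟨ +-congˡ (-‿cong (trans (∑-const {suc q} λ _ → refl) (proj₂ (divide Q≉0 (edgeSum v i))))) ⟩
          edgeSum v i - edgeSum v i        ≈⟨ -‿inverseʳ _ ⟩
          0#                               ∎) ,
        (λ i j → trans (assemble-≈ (v o) g i j) (sym (assemble-≈ (v o) g i zero))) ,
        remainder-+ v g
    ; independent = λ u w (uo≈0 , eu≈0) Ww u+w≈0 → vanish u w u+w≈0 uo≈0 λ i j →
        trans (Ww i j) (cancelˡ Q≉0 (begin
          Q * w (ℓ i zero)              ≈⟨ edgeSum-W₁ w Ww i ⟨
          edgeSum w i                   ≈⟨ +-identityˡ _ ⟨
          0# + edgeSum w i              ≈⟨ +-congʳ (eu≈0 i) ⟨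
          edgeSum u i + edgeSum w i     ≈⟨ edgeSum-+ u w i ⟨
          edgeSum (u ⊞ w) i             ≈⟨ ∑-zero {suc q} (λ j → u+w≈0 (ℓ i j)) ⟩
          0#                            ∎))
    }

  directSum₁ : ¬ (Q ≈ 0#) → ¬ (P ≈ 0#) → DirectSum W₁ U₁ W₂
  directSum₁ Q≉0 P≉0 = record
    { closedˡ = closed-U₁
    ; closedʳ = closed-W₂
    ; ⊆ˡ = proj₁
    ; ⊆ʳ = λ {v} → W₂⊆W₁ v
    ; decompose = λ v Wv →
        -- The value `t` is the average over all leaves; dividing by P and then by Q makes the total
        -- of the remainder 0.
        let m , Pm≈ = divide P≉0 (total v)
            t , Qt≈ = divide Q≉0 m
            g = λ _ _ → t
        in
        remainder v g , assemble (v o) g ,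
        ((λ i j → trans (assemble-≈ 0# (λ i j → v (ℓ i j) - g i j) i j)
          (trans (+-congʳ (Wv i j)) (sym (assemble-≈ 0# (λ i j → v (ℓ i j) - g i j) i zero)))) , refl , (begin
          total (remainder v g)                        ≈⟨ total-remainder v g ⟩
          total v - ∑ {suc p} (λ i → ∑ {suc q} (g i))  ≈⟨ +-congˡ (-‿cong (trans
            (∑-const {suc p} λ i → trans (∑-const {suc q} λ _ → refl) Qt≈) Pm≈)) ⟩
          total v - total v                            ≈⟨ -‿inverseʳ _ ⟩
          0#                                           ∎)) ,
        (λ i j → trans (assemble-≈ (v o) g i j) (sym (assemble-≈ (v o) g zero zero))) ,
        remainder-+ v g
    ; independent = λ u w (_ , uo≈0 , tu≈0) Ww u+w≈0 → vanish u w u+w≈0 uo≈0 λ i j →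
        trans (Ww i j) (cancelˡ Q≉0 (cancelˡ P≉0 (begin
          P * (Q * w (ℓ zero zero))     ≈⟨ total-W₂ w Ww ⟨
          total w                       ≈⟨ +-identityˡ _ ⟨
          0# + total w                  ≈⟨ +-congʳ tu≈0 ⟨
          total u + total w             ≈⟨ total-+ u w ⟨
          total (u ⊞ w)                 ≈⟨ ∑-zero {suc p} (λ i → ∑-zero {suc q} λ j → u+w≈0 (ℓ i j)) ⟩
          0#                            ∎)))
    }

  lineVector : Carrier → Carrier → Vector Carrier N
  lineVector r t = assemble {suc p} {suc q} (r * t) (λ _ _ → t)

  lineVector-leaf : ∀ r t i j → lineVector r t (ℓ i j) ≈ t
  lineVector-leaf r t = assemble-≈ (r * t) (λ _ _ → t)

  Line-lineVector : ∀ r t → Line r (lineVector r t)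
  Line-lineVector r t = (λ i j → trans (lineVector-leaf r t i j) (sym (lineVector-leaf r t zero zero))) ,
    *-congˡ (sym (lineVector-leaf r t zero zero))

  Line-null : ∀ r v → Line r v → v (ℓ zero zero) ≈ 0# → ∀ x → v x ≈ 0#
  Line-null r v (W , v₀≈) t≈0 = ∀-vertex {suc p} (λ x → v x ≈ 0#)
    (trans v₀≈ (trans (*-congˡ t≈0) (zeroʳ r))) λ i j → trans (W i j) t≈0

  directSum₂ : ∀ {r s} → ¬ (r ≈ s) → DirectSum W₂ (Line r) (Line s)
  directSum₂ {r} {s} r≉s = record
    { closedˡ = closed-Line r
    ; closedʳ = closed-Line s
    ; ⊆ˡ = proj₁
    ; ⊆ʳ = proj₁
    ; decompose = λ v Wv →
        let t = v (ℓ zero zero)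
            -- Cramer's rule for a + b = t and ra + sb = c, where c is the centre value and d the
            -- inverse of the determinant r - s.
            a = d * (v o - s * t)
            b = d * (r * t - v o)
        in lineVector r a , lineVector s b , Line-lineVector r a , Line-lineVector s b ,
           ∀-vertex {suc p} (λ x → v x ≈ lineVector r a x + lineVector s b x)
             (sym (trans (solve 5 (λ d r s t c → r :* (d :* (c :- s :* t)) :+ s :* (d :* (r :* t :- c)) := d :* (r :- s) :* c)
                  refl d r s t (v o))
               (d[r-s]x≈x (v o))))
             λ i j → trans (Wv i j) (sym (trans (+-cong (lineVector-leaf r a i j) (lineVector-leaf s b i j))
               (trans (solve 5 (λ d r s t c → d :* (c :- s :* t) :+ d :* (r :* t :- c) := d :* (r :- s) :* t)
                    refl d r s t (v o))
                 (d[r-s]x≈x t))))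
    ; independent = λ u w Lu@(_ , u₀≈) (_ , w₀≈) u+w≈0 →
        let x = u (ℓ zero zero)
            y = w (ℓ zero zero)
        in Line-null r u Lu (begin
          x                              ≈⟨ d[r-s]x≈x x ⟨
          -- The multiple (r - s)x is the centre equation rx + sy = 0 minus s times the leaf
          -- equation x + y = 0.
          d * (r - s) * x
            ≈⟨ solve 5 (λ d r s x y → d :* (r :- s) :* x := d :* ((r :* x :+ s :* y) :- s :* (x :+ y))) refl d r s x y ⟩
          d * ((r * x + s * y) - s * (x + y))
            ≈⟨ *-congˡ (+-cong (trans (+-cong (sym u₀≈) (sym w₀≈)) (u+w≈0 o)) (-‿cong (*-congˡ (u+w≈0 (ℓ zero zero))))) ⟩
          d * (0# - s * 0#)              ≈⟨ solve 2 (λ d s → d :* (con (+ 0) :- s :* con (+ 0)) := con (+ 0)) refl d s ⟩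
          0#                             ∎)
    }
    where
    d : Carrier
    d = proj₁ (invertible r≉s)
    d[r-s]x≈x : ∀ x → d * (r - s) * x ≈ x
    d[r-s]x≈x x = trans (*-congʳ (proj₂ (invertible r≉s))) (*-identityˡ x)

  -- The trivial splitting lets `diagonal-∷` treat the last line like the other summands, and the
  -- recursion ends at the zero space.
  directSum₃ : ∀ r → DirectSum (Line r) (Line r) Null
  directSum₃ r = record
    { closedˡ = closed-Line r
    ; closedʳ = closed-Null
    ; ⊆ˡ = id
    ; ⊆ʳ = λ Z → (λ i j → trans (Z (ℓ i j)) (sym (Z (ℓ zero zero)))) ,
        trans (Z o) (sym (trans (*-congˡ (Z (ℓ zero zero))) (zeroʳ r)))
    ; decompose = λ v Lv → v , (λ _ → 0#) , Lv , (λ _ → refl) , λ i → sym (+-identityʳ (v i))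
    ; independent = λ u w _ Zw u+w≈0 i → trans (trans (sym (+-identityʳ (u i))) (+-congˡ (sym (Zw i)))) (u+w≈0 i)
    }

  -- Bases and dimensions of the summands

  -- Parametrises the hyperplane of vectors with entry sum 0 by all entries but the first.
  zeroSum : ∀ {m} → Vector Carrier m → Vector Carrier (suc m)
  zeroSum {m} a zero = - ∑ {m} a
  zeroSum a (suc i) = a i

  ∑-zeroSum : ∀ {m} (a : Vector Carrier m) → ∑ {suc m} (zeroSum a) ≈ 0#
  ∑-zeroSum {m} a = -‿inverseˡ (∑ {m} a)

  zeroSum-tail : ∀ {m} (v : Vector Carrier (suc m)) → ∑ {suc m} v ≈ 0# → v ≋ zeroSum (v ∘ suc)
  zeroSum-tail {m} v ∑v≈0 zero = begin
    v zero                    ≈⟨ solve 2 (λ x y → x := x :+ y :- y) refl (v zero) s ⟩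
    v zero + s - s            ≈⟨ +-congʳ ∑v≈0 ⟩
    0# - s                    ≈⟨ +-identityˡ _ ⟩
    - s                       ∎
    where s = ∑ {m} (v ∘ suc)
  zeroSum-tail v ∑v≈0 (suc i) = refl

  functional-zeroSum : ∀ {m k} {f : Vector Carrier m → Vector Carrier k} →
    (∀ j → Functional (λ a → f a j)) → ∀ i → Functional {m} (λ a → zeroSum (f a) i)
  functional-zeroSum F zero    = functional-neg (functional-∑ F)
  functional-zeroSum F (suc i) = F i

  -- On each of the p + 1 edges, the q leaves after the first are free and the first is determined
  -- by the zero edge sum.
  dimension-U₀ : HasDimension U₀ (suc p ℕ.* q)
  dimension-U₀ = dimension-parametrised {suc p ℕ.* q} φ
    (functional-assemble functional-0 λ i → functional-zeroSum {f = λ a j → a (combine i j)} λ j → functional-coordinate (combine i j))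
    (λ a → refl , λ i → trans (edgeSum-assemble 0# (λ i → zeroSum (λ j → a (combine i j))) i) (∑-zeroSum λ j → a (combine i j)))
    (λ a φa≈0 x → ≡.subst (λ x → a x ≈ 0#) (combine-remQuot {suc p} q x)
      (let i , j = remQuot {suc p} q x in
       trans (sym (assemble-≈ 0# (λ i → zeroSum (λ j → a (combine i j))) i (suc j))) (φa≈0 (ℓ i (suc j)))))
    λ v (v₀≈0 , e≈0) → coordinates v , ∀-vertex {suc p} (λ x → v x ≈ φ (coordinates v) x) v₀≈0 λ i j →
      trans (zeroSum-tail (λ j → v (ℓ i j)) (e≈0 i) j)
        (sym (trans (assemble-≈ 0# (λ i → zeroSum (λ j → coordinates v (combine i j))) i j)
          (zeroSum-cong (λ j → reflexive (≡.cong (λ (i , j) → v (ℓ i (suc j))) (remQuot-combine {suc p} i j))) j)))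
    where
    φ : Vector Carrier (suc p ℕ.* q) → Vector Carrier N
    φ a = assemble {suc p} {suc q} 0# (λ i → zeroSum (λ j → a (combine i j)))
    coordinates : Vector Carrier N → Vector Carrier (suc p ℕ.* q)
    coordinates v x = let i , j = remQuot {suc p} q x in v (ℓ i (suc j))
    zeroSum-cong : ∀ {m} {a b : Vector Carrier m} → a ≋ b → zeroSum a ≋ zeroSum b
    zeroSum-cong {m} a≋b zero    = -‿cong (sum-cong-≋ {m} a≋b)
    zeroSum-cong a≋b (suc i) = a≋b i

  -- The coordinates are the values on all edges but the first. The total is Q times the sum of the
  -- edge values, so as Q is nonzero these values sum to 0.
  dimension-U₁ : ¬ (Q ≈ 0#) → HasDimension U₁ p
  dimension-U₁ Q≉0 = dimension-parametrised {p} φ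
    (functional-assemble functional-0 λ i _ → functional-zeroSum {f = λ a → a} functional-coordinate i)
    (λ a → (λ i j → trans (φ-leaf a i j) (sym (φ-leaf a i zero))) , refl , (begin
      total (φ a)                                   ≈⟨ total-assemble 0# (λ i _ → zeroSum a i) ⟩
      ∑ {suc p} (λ i → ∑ {suc q} (λ _ → zeroSum a i)) ≈⟨ sum-cong-≋ {suc p} (λ i → ∑-const {suc q} {x = zeroSum a i} λ _ → refl) ⟩
      ∑ {suc p} (λ i → Q * zeroSum a i)             ≈⟨ *-distribˡ-sum {suc p} Q (zeroSum a) ⟨
      Q * ∑ {suc p} (zeroSum a)                     ≈⟨ *-congˡ (∑-zeroSum a) ⟩
      Q * 0#                                        ≈⟨ zeroʳ Q ⟩
      0#                                            ∎))
    (λ a φa≈0 i → trans (sym (φ-leaf a (suc i) zero)) (φa≈0 (ℓ (suc i) zero)))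
    λ v (W , v₀≈0 , T≈0) → (λ i → v (ℓ (suc i) zero)) ,
      ∀-vertex {suc p} (λ x → v x ≈ φ (λ i → v (ℓ (suc i) zero)) x) v₀≈0 λ i j → trans (W i j)
        (trans (zeroSum-tail (λ i → v (ℓ i zero)) (cancelˡ Q≉0 (begin
          Q * ∑ {suc p} (λ i → v (ℓ i zero))       ≈⟨ *-distribˡ-sum {suc p} Q (λ i → v (ℓ i zero)) ⟩
          ∑ {suc p} (λ i → Q * v (ℓ i zero))       ≈⟨ sum-cong-≋ {suc p} (edgeSum-W₁ v W) ⟨
          total v                                  ≈⟨ T≈0 ⟩
          0#                                       ∎)) i) (sym (φ-leaf (λ i → v (ℓ (suc i) zero)) i j)))
    where
    φ : Vector Carrier p → Vector Carrier N
    φ a = assemble {suc p} {suc q} 0# (λ i _ → zeroSum a i)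
    φ-leaf : ∀ a i j → φ a (ℓ i j) ≈ zeroSum a i
    φ-leaf a = assemble-≈ 0# (λ i _ → zeroSum a i)

  dimension-Line : ∀ r → HasDimension (Line r) 1
  dimension-Line r = dimension-parametrised {1} (λ a → lineVector r (a zero))
    (functional-assemble (functional-*ˡ r (functional-coordinate zero)) λ _ _ → functional-coordinate zero)
    (λ a → Line-lineVector r (a zero))
    (λ { a φa≈0 zero → trans (sym (lineVector-leaf r (a zero) zero zero)) (φa≈0 (ℓ zero zero)) })
    λ v (W , v₀≈) → (λ _ → v (ℓ zero zero)) ,
      ∀-vertex {suc p} (λ x → v x ≈ lineVector r (v (ℓ zero zero)) x) v₀≈ λ i j →
        trans (W i j) (sym (lineVector-leaf r (v (ℓ zero zero)) i j))

  -- Assembling the spectrum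

  symbol : Carrier → Carrier → List (Carrier × ℕ)
  symbol r₁ r₂ =
    (ι (+ 1) , suc p ℕ.* q) ∷ (ι (+ 3 ℤ.- + 2 ℤ.* + suc (suc q)) , p) ∷ (r₁ , 1) ∷ (r₂ , 1) ∷ []

  spectrum : ¬ (Q ≈ 0#) → ¬ (P ≈ 0#) → ∀ r₁ r₂ →
    r₁ + r₂ ≈ Q * (P - ι (+ 2)) + ι (+ 1) → r₁ * r₂ ≈ - (P * Q) → ¬ (r₁ ≈ r₂) →
    HasSpectrum S (symbol r₁ r₂)
  spectrum Q≉0 P≉0 r₁ r₂ r₁+r₂ r₁r₂ r₁≉r₂ =
    -- The whole space is encoded as the always true predicate `v ≋ v`, which is dropped from the
    -- intersection here.
    (λ x → dimension-resp (λ _ → proj₂) (λ v Ev → v , ((λ _ → refl) , Ev) , λ _ → refl) (diagonal x)) , count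
    where
    r₁-line : ∀ {v} → Line r₂ v → Eigenspace S r₁ v
    r₁-line {v} = Line⊆E r₁+r₂ r₁r₂ {v}
    r₂-line : ∀ {v} → Line r₁ v → Eigenspace S r₂ v
    r₂-line {v} = Line⊆E (trans (+-comm r₂ r₁) r₁+r₂) (trans (*-comm r₂ r₁) r₁r₂) {v}
    diagonal : Diagonal (λ v → v ≋ v) (symbol r₁ r₂)
    diagonal =
      diagonal-∷ (directSum₀ Q≉0) U₀⊆E (λ {v} → invariant-W₁ {v}) dimension-U₀
      (diagonal-∷ (directSum₁ Q≉0 P≉0) U₁⊆E (λ {v} → invariant-W₂ {v}) (dimension-U₁ Q≉0)
      -- The line of r₂ comes first because it carries the eigenvalue r₁.
      (diagonal-∷ (directSum₂ (r₁≉r₂ ∘ sym)) r₁-line (λ {v} → invariant-Line r₂-line {v}) (dimension-Line r₂)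
      (diagonal-∷ (directSum₃ r₁) r₂-line (λ {v} → invariant-Null {v}) (dimension-Line r₁)
      (diagonal-[] λ v Z → Z))))
    count : suc p ℕ.* q ℕ.+ (p ℕ.+ 2) ≡ N
    count = vertex-count p q

theorem4p2 : ∀ {c ℓ₁ ℓ₂} (K : HeytingField c ℓ₁ ℓ₂) (_#?_ : Decidable (HeytingField._#_ K)) →
    let open HeytingField K
        open Field K _#?_
    in
    CharacteristicZero →
    (n k : ℕ) (2≤n : 2 ≤ n) (2≤k : 2 ≤ k) (r₁ r₂ : Carrier) →
    (∀ x → (x * x - ι ((+ k ℤ.- + 1) ℤ.* (+ n ℤ.- + 3) ℤ.+ + 1) * x
              - ι ((+ n ℤ.- + 1) ℤ.* (+ k ℤ.- + 1)) ≈ 0#)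
           ⇔ (x ≈ r₁ ⊎ x ≈ r₂)) →
    HasSeidelSpectrum (hyperstar n k 2≤k)
      ( (ι (+ 1)                   , (n ∸ 1) ℕ.* (k ∸ 2))
      ∷ (ι (+ 3 ℤ.- + 2 ℤ.* + k)   , n ∸ 2)
      ∷ (r₁                        , 1)
      ∷ (r₂                        , 1)
      ∷ [] )
theorem4p2 K _#?_ char0 (suc (suc p)) (suc (suc q)) (s≤s (s≤s _)) (s≤s 0<q) r₁ r₂ roots =
  let open Quadratic K _#?_
      sum , product , r₁≉r₂ = vieta _ _ r₁ r₂
        -- The last argument is the predecessor of (n - 1)(k - 1), as `no-double-root` takes the
        -- constant term in successor form; `char0 q` and `char0 p` likewise say that k - 1 and n -
        -- 1 are nonzero in K.
        (no-double-root char0 (+ suc q ℤ.* (+ suc (suc p) ℤ.- + 3) ℤ.+ + 1) (q ℕ.+ p ℕ.* suc q)) roots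
  in HyperstarSpectrum.spectrum K _#?_ p q 0<q (char0 q) (char0 p) r₁ r₂
       (trans sum (ι-sum p q)) (trans product (-‿cong (ι-homo-* (+ suc p) (+ suc q)))) r₁≉r₂
  where
  open FieldProperties K _#?_
  -- Rests on n - 3 = (n - 1) - 2; it brings the linear coefficient of the equation into the form
  -- used by `spectrum`.
  ι-sum : ∀ p q → ι (+ suc q ℤ.* (+ suc (suc p) ℤ.- + 3) ℤ.+ + 1) ≈
                  ι (+ suc q) * (ι (+ suc p) - ι (+ 2)) + ι (+ 1)
  ι-sum p q = begin
    ι (+ suc q ℤ.* (+ suc (suc p) ℤ.- + 3) ℤ.+ + 1)
      ≈⟨ ι-homo-+ (+ suc q ℤ.* (+ suc (suc p) ℤ.- + 3)) (+ 1) ⟩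
    ι (+ suc q ℤ.* (+ suc (suc p) ℤ.- + 3)) + ι (+ 1)
      ≈⟨ +-congʳ (trans (ι-homo-* (+ suc q) (+ suc (suc p) ℤ.- + 3)) (*-congˡ (ι-homo-- (+ suc (suc p)) (+ 3)))) ⟩
    ι (+ suc q) * (ι (+ suc (suc p)) - ι (+ 3)) + ι (+ 1)
      ≈⟨ +-congʳ (*-congˡ (trans (+-congʳ (ι-homo-+ (+ 1) (+ suc p)))
           (solve 1 (λ P → con (+ 1) :+ P :- con (+ 3) := P :- con (+ 2)) refl (ι (+ suc p))))) ⟩
    ι (+ suc q) * (ι (+ suc p) - ι (+ 2)) + ι (+ 1) ∎
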